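{- For $k\ge3$ and $n\ge2$, $$p_n(\Sigma_k)-p_n(\Sigma_{k-1})=C(n,k)=L_k(n)-\sum_{i=2}^{k-1}\binom{n+k-i}{k-i}C(n,i),$$ where $L_k(n)=\frac1n\sum_{d\mid n}\mu(d)k^{n/d}$ and $\mu$ is the Möbius function.
   Context: For $\sigma\in\{+,-\}^k$ ($k\ge2$), let $\mathcal W_k$ be the set of infinite words over $\{0,\dots,k-1\}$ with the linear order $\prec_\sigma$: for $s\neq t$, with $j$ the first index where $s_j\neq t_j$ and $c=|\{i<j:\sigma_{s_i}=-\}|$, $s\prec_\sigma t$ iff ($c$ even and $s_j<t_j$) or ($c$ odd and $s_j>t_j$). The signed shift $\Sigma_\sigma$ deletes the first letter of a word. Let $\mathcal W_{k,n}$ be the set of words $(s_1\dots s_n)^\infty$ with $s_1\dots s_n$ primitive (not a power of a shorter word). For $s\in\mathcal W_{k,n}$ let $\Pi_\sigma(s)\in\mathcal S_n$ be the permutation with $\Pi_\sigma(s)_i<\Pi_\sigma(s)_j$ iff $s_is_{i+1}\dots\prec_\sigma s_js_{j+1}\dots$. Let $\mathcal P_n(\Sigma_\sigma)=\{\Pi_\sigma(s):s\in\mathcal W_{k,n}\}$ and $p_n(\Sigma_\sigma)=|\mathcal P_n(\Sigma_\sigma)|/n$ (the number of classes of $\mathcal P_n(\Sigma_\sigma)$ under cyclic rotation). $\Sigma_k$ denotes the $k$-shift $\Sigma_{+^k}$ (all signs $+$). $C(n,i)$ denotes the number of cyclic permutations ($n$-cycles) in $\mathcal S_n$ with exactly $i-1$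 descents, a descent of $\tau$ being an $i\in[n-1]$ with $\tau_i>\tau_{i+1}$. -}

module Defs where

open import Data.Nat as ℕ using (ℕ; zero; suc; _+_; _*_; _∸_; _^_; _<_; _≤_; NonZero)
open import Data.Nat.DivMod using (_mod_; _/_)
open import Data.Nat.Divisibility using (_∣_; _∣?_)
open import Data.Nat.Primality using (prime?)
open import Data.Nat.Combinatorics using (_C_)
open import Data.Integer as ℤ using (ℤ; +_)
open import Data.Rational as ℚ using (ℚ)
open import Data.Fin as Fin using (Fin; toℕ)
open import Data.Vec using (Vec; lookup; toList)
open import Data.List as List using (List; []; _∷_; length; upTo; filter)
open import Data.List.Relation.Unary.Unique.Propositional using (Unique)
open import Data.List.Membership.Propositional using (_∈_)
open import Data.Product using (Σ; ∃; _×_; _,_)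
open import Data.Bool using (Bool; true; false; if_then_else_; not)
open import Function using (_∘_)
open import Data.Bool.ListAction using (and)
open import Function.Bundles using (_⇔_)
open import Relation.Binary.PropositionalEquality using (_≡_)
open import Relation.Nullary using (¬_; does)
open import Relation.Nullary.Decidable using (_×-dec_)

HasSize : {A : Set} → (A → Set) → ℕ → Set
HasSize {A} P m =
  Σ (List A) λ xs → Unique xs × (∀ x → (x ∈ xs) ⇔ P x) × (length xs ≡ m)

data Sign : Set where
  plus minus : Sign

Word : ℕ → Set
Word k = ℕ → Fin k

isMinus : Sign → Bool
isMinus plus  = false
isMinus minus = true

negCount : {k : ℕ} → (Fin k → Sign) → Word k → ℕ → ℕ
negCount σ s zero    = zero
negCount σ s (suc j) = negCount σ s j + (if isMinus (σ (s j)) then 1 else 0)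

evenᵇ : ℕ → Bool
evenᵇ zero          = true
evenᵇ (suc zero)    = false
evenᵇ (suc (suc n)) = evenᵇ n

_≺⟨_⟩_ : {k : ℕ} → Word k → (Fin k → Sign) → Word k → Set
s ≺⟨ σ ⟩ t = ∃ λ j → (∀ i → i < j → s i ≡ t i) ×
  (if evenᵇ (negCount σ s j) then (s j Fin.< t j) else (t j Fin.< s j))

-- the k-shift Σ_k = Σ_{+^k}
allPlus : (k : ℕ) → Fin k → Sign
allPlus k _ = plus

shiftBy : {k : ℕ} → ℕ → Word k → Word k
shiftBy i s m = s (i + m)

periodic : {k n : ℕ} .{{_ : NonZero n}} → Vec (Fin k) n → Word k
periodic {n = n} w m = lookup w (m mod n)

IsPower : {k n : ℕ} → Vec (Fin k) n → Set
IsPower {k} {n} w = ∃ λ d → (suc d < n) × (suc d ∣ n) ×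
  Σ (Vec (Fin k) (suc d)) λ u → ∀ (i : Fin n) → lookup w i ≡ lookup u (toℕ i mod suc d)

Primitive : {k n : ℕ} → Vec (Fin k) n → Set
Primitive w = ¬ IsPower w

IsPerm : {n : ℕ} → Vec (Fin n) n → Set
IsPerm π = ∀ i j → lookup π i ≡ lookup π j → i ≡ j

-- Π_σ(s) = π  for s = w^∞ (positions 1..n ↦ Fin n indices 0..n-1)
IsPatternOf : {k n : ℕ} .{{_ : NonZero n}} → (Fin k → Sign) →
              Vec (Fin k) n → Vec (Fin n) n → Set
IsPatternOf σ w π = ∀ i j →
  (lookup π i Fin.< lookup π j) ⇔
  (shiftBy (toℕ i) (periodic w) ≺⟨ σ ⟩ shiftBy (toℕ j) (periodic w))

InPatterns : {k : ℕ} → (Fin k → Sign) → (n : ℕ) .{{_ : NonZero n}} →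
             Vec (Fin n) n → Set
InPatterns {k} σ n π = IsPerm π ×
  Σ (Vec (Fin k) n) λ w → Primitive w × IsPatternOf σ w π

iter : {n : ℕ} → Vec (Fin n) n → ℕ → Fin n → Fin n
iter π zero    x = x
iter π (suc j) x = lookup π (iter π j x)

IsCyclic : {n : ℕ} → Vec (Fin n) n → Set
IsCyclic π = IsPerm π × (∀ x y → ∃ λ j → iter π j x ≡ y)

descentsL : {n : ℕ} → List (Fin n) → ℕ
descentsL []           = 0
descentsL (x ∷ [])     = 0
descentsL (x ∷ y ∷ xs) = (if does (y Fin.<? x) then 1 else 0) + descentsL (y ∷ xs)

descents : {n : ℕ} → Vec (Fin n) n → ℕ
descents π = descentsL (toList π)

CycDesc : (n i : ℕ) → Vec (Fin n) n → Set
CycDesc n i π = IsCyclic π × (descents π + 1 ≡ i)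

primeDivisors : ℕ → List ℕ
primeDivisors d = filter (λ p → prime? p ×-dec (p ∣? d)) (upTo (suc d))

squarefreeᵇ : ℕ → Bool
squarefreeᵇ d = and (List.map (λ p → not (does ((p * p) ∣? d))) (primeDivisors d))

μ : ℕ → ℤ
μ d = if squarefreeᵇ d then ℤ.-[1+ 0 ] ℤ.^ length (primeDivisors d) else + 0

sumℤ : List ℤ → ℤ
sumℤ = List.foldr ℤ._+_ (+ 0)

sumℚ : List ℚ → ℚ
sumℚ = List.foldr ℚ._+_ ℚ.0ℚ

mobiusSum : ℕ → ℕ → ℤ
mobiusSum k n = sumℤ (List.map term (upTo n))
  where
    term : ℕ → ℤ
    term m = if does (suc m ∣? n) then μ (suc m) ℤ.* (+ (k ^ (n / suc m))) else + 0

L : (k n : ℕ) .{{_ : NonZero n}} → ℚ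
L k n = mobiusSum k n ℚ./ n

ℕtoℚ : ℕ → ℚ
ℕtoℚ m = (+ m) ℚ./ 1

binomSum : (k n : ℕ) → (ℕ → ℕ) → ℚ
binomSum k n c =
  sumℚ (List.map (λ i → ℕtoℚ ((((n + k) ∸ i) C (k ∸ i)) * c i))
                 (List.map (λ i → 2 + i) (upTo (k ∸ 2))))

{-# OPTIONS --safe #-}
-- A pattern π of a primitive word w of length n is recorded by the n-cycle τ with τ(π_i) = π_{i+1},
-- the root π_1, and the labelling a with a(π_i) = w_i.  The labelling is weakly increasing, and
-- strictly so at the descents of τ.  Conversely, every rooted n-cycle with such a labelling codes a
-- primitive word whose pattern is the orbit of the root.  Hence the patterns of the k-shift are the
-- rooted n-cycles with at most k-1 descents, which gives the first equality.  An n-cycle with i-1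
-- descents has binom(n+k-i, k-i) labellings by k letters, so n Σ_{i≤k} binom(n+k-i, k-i) C(n,i)
-- counts primitive words, as does n L_k(n) by Möbius inversion; this is the second equality.
module Submission where

open import Defs
open import Data.Nat using (ℕ; _≤_; _∸_; NonZero)
open import Data.Integer using (+_)
open import Data.Rational using (_/_; _-_)
open import Data.Product using (_×_)
open import Relation.Binary.PropositionalEquality using (_≡_)

open import Data.Bool using (Bool; true; false; if_then_else_; not)
open import Data.Bool.ListAction using (and)
open import Data.Empty using (⊥-elim)
open import Data.Fin as Fin using (Fin; zero; suc; toℕ; fromℕ<)
import Data.Fin.Properties as Finₚ
open import Data.Fin.Properties using (toℕ<n; toℕ-injective; toℕ-fromℕ<)
open import Data.Integer as ℤ using (ℤ)
import Data.Integer.Properties as ℤₚ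
open import Data.List as List using (List; []; _∷_; length; filter; upTo)
import Data.List.Properties as Listₚ
open import Data.List.Membership.Propositional using (_∈_; lose)
open import Data.List.Membership.Propositional.Properties
open import Data.List.Membership.Propositional.Properties.WithK using (unique∧set⇒bag)
open import Data.List.Relation.Binary.BagAndSetEquality using (∼bag⇒↭)
open import Data.List.Relation.Binary.Permutation.Propositional using (_↭_; ↭⇒↭ₛ)
open import Data.List.Relation.Binary.Permutation.Propositional.Properties using (↭-length; map⁺)
open import Data.List.Relation.Binary.Permutation.Setoid.Properties using (foldr-commMonoid)
open import Data.List.Relation.Unary.All as All using ([]; _∷_)
open import Data.List.Relation.Unary.AllPairs using ([]; _∷_)
open import Data.List.Relation.Unary.Any using (here; there)
open import Data.List.Relation.Unary.Unique.Propositional using (Unique)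
import Data.List.Relation.Unary.Unique.Propositional.Properties as Uniqueₚ
open import Data.Nat as ℕ using (zero; suc; _+_; _*_; _^_; _<_; _%_; z≤n; s≤s)
open import Data.Nat.Combinatorics using (_C_; k>n⇒nCk≡0; nC1≡n; nCn≡1; nCk≡nC[n∸k]; nCk+nC[k+1]≡[n+1]C[k+1])
import Data.Nat.DivMod as DivMod
open import Data.Nat.DivMod using (_mod_; m%n<n; m≡m%n+[m/n]*n; m<n⇒m%n≡m; m∣n⇒o%n%m≡o%m)
import Data.Nat.Divisibility as Div
open import Data.Nat.Divisibility using (_∣_; _∣?_; divides)
open import Data.Nat.ListAction using (sum; product)
open import Data.Nat.ListAction.Properties using (sum-++)
open import Data.Nat.Primality using (Prime; prime?; euclidsLemma; prime⇒irreducible; prime⇒nonZero; prime⇒nonTrivial)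
open import Data.Nat.Primality.Factorisation using (factorise)
import Data.Nat.Properties as ℕₚ
open import Data.Nat.Solver using (module +-*-Solver)
open import Data.Product using (Σ; ∃; _,_; proj₁; proj₂)
import Data.Rational as ℚ
import Data.Rational.Properties as ℚₚ
import Data.Rational.Unnormalised as ℚᵘ
import Data.Rational.Unnormalised.Properties as ℚᵘₚ
open import Data.Sum using (_⊎_; inj₁; inj₂; [_,_]′)
open import Data.Unit using (⊤; tt)
open import Data.Vec using (Vec; []; _∷_; lookup; toList; tabulate)
import Data.Vec.Properties as Vecₚ
open import Data.Vec.Properties using (lookup∘tabulate)
open import Function using (_∘_; id)
open import Function.Bundles using (_⇔_; mk⇔; Equivalence)
import Function.Properties.Equivalence as ⇔
open import Relation.Binary.Definitions using (tri<; tri≈; tri>)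
open import Relation.Binary.PropositionalEquality using (_≢_; _≗_; refl; sym; trans; cong; cong₂; subst; subst₂; setoid; module ≡-Reasoning)
open import Relation.Nullary using (¬_; Dec; yes; no; does; contradiction)
open import Relation.Nullary.Decidable using (dec-true; dec-false; map′; ¬?; _×-dec_)
open import Relation.Unary using (Decidable)

open Equivalence using (to; from)

-- Counting

-- Both counts rest on one coding. A word remembers the cycle, the root and the labelling, whereas
-- its pattern remembers only the cycle and the root. For patterns it is therefore enough that some
-- labelling exists, which for a cycle with i - 1 descents means i ≤ k; for words the number of
-- labellings matters. The root contributes the factor n that the division by n removes. Descents
-- enter because comparing two itineraries needs `τ` to preserve the order of any two positions with
-- equal labels. For weakly increasing labels this need only be tested on neighbours, and in that
-- local form labellings can be counted by recursion. The delicate point of the coding is that two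
-- points of a cycle never share an itinerary: this gives both primitivity and the strict order of
-- the shifts. Words being infinite, the point is settled by a bound on how long two itineraries can
-- agree.

unique∧set⇒↭ : {A : Set} {xs ys : List A} → Unique xs → Unique ys →
               (∀ x → x ∈ xs → x ∈ ys) → (∀ x → x ∈ ys → x ∈ xs) → xs ↭ ys
unique∧set⇒↭ u v f g = ∼bag⇒↭ (unique∧set⇒bag u v (mk⇔ (f _) (g _)))

-- Turns each enumeration of the same set into an equation between numbers; this is how the given
-- `a`, `b` and `c` meet the explicit sums. Two duplicate-free lists with the same elements are
-- permutations of each other.
HasSize-unique : {A : Set} {P : A → Set} {m m′ : ℕ} → HasSize P m → HasSize P m′ → m ≡ m′
HasSize-unique (xs , u , p , refl) (ys , v , q , refl) =
  ↭-length (unique∧set⇒↭ u v (λ x → from (q x) ∘ to (p x)) (λ x → from (p x) ∘ to (q x)))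

map-unique : {A B : Set} (f : A → B) (xs : List A) →
             (∀ {x y} → x ∈ xs → y ∈ xs → f x ≡ f y → x ≡ y) → Unique xs → Unique (List.map f xs)
map-unique f []       inj []       = []
map-unique f (x ∷ xs) inj (x∉ ∷ u) =
  All.tabulate (λ y∈ fx≡y → let (z , z∈ , y≡fz) = ∈-map⁻ f y∈ in
    All.lookup x∉ z∈ (inj (here refl) (there z∈) (trans fx≡y y≡fz)))
  ∷ map-unique f xs (λ p q → inj (there p) (there q)) u

HasSize-bij : {A B : Set} {P : A → Set} {Q : B → Set} {m : ℕ} (f : A → B) →
              (∀ {x} → P x → Q (f x)) →
              (∀ {x y} → P x → P y → f x ≡ f y → x ≡ y) →
              (∀ {y} → Q y → ∃ λ x → P x × f x ≡ y) →
              HasSize P m → HasSize Q m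
HasSize-bij {Q = Q} f pres inj surj (xs , u , p , refl) =
  List.map f xs ,
  map-unique f xs (λ x∈ y∈ → inj (to (p _) x∈) (to (p _) y∈)) u ,
  (λ y → mk⇔
    (λ y∈ → let (x , x∈ , y≡) = ∈-map⁻ f y∈ in subst Q (sym y≡) (pres (to (p x) x∈)))
    (λ q → let (x , px , fx≡y) = surj q in subst (_∈ List.map f xs) fx≡y (∈-map⁺ f (from (p x) px)))) ,
  Listₚ.length-map f xs

HasSize-⇔ : {A : Set} {P Q : A → Set} {m : ℕ} →
            (∀ {x} → P x → Q x) → (∀ {x} → Q x → P x) → HasSize P m → HasSize Q m
HasSize-⇔ f g = HasSize-bij id f (λ _ _ → id) (λ q → _ , g q , refl)

HasSize-⊎ : {A : Set} {P Q : A → Set} {m m′ : ℕ} → (∀ {x} → P x → ¬ Q x) →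
            HasSize P m → HasSize Q m′ → HasSize (λ x → P x ⊎ Q x) (m + m′)
HasSize-⊎ disj (xs , u , p , refl) (ys , v , q , refl) =
  xs List.++ ys ,
  Uniqueₚ.++⁺ u v (λ (x∈ , x∈′) → disj (to (p _) x∈) (to (q _) x∈′)) ,
  (λ x → mk⇔ (λ x∈ → [ inj₁ ∘ to (p x) , inj₂ ∘ to (q x) ]′ (∈-++⁻ xs x∈))
             [ ∈-++⁺ˡ ∘ from (p x) , ∈-++⁺ʳ xs ∘ from (q x) ]′) ,
  Listₚ.length-++ xs

HasSize-∅ : {A : Set} {P : A → Set} → (∀ {x} → ¬ P x) → HasSize P 0
HasSize-∅ ¬p = [] , [] , (λ x → mk⇔ (λ ()) (λ p → contradiction p ¬p)) , refl

HasSize-Σ : {I B : Set} {is : List I} {Q : I → B → Set} (f : I → ℕ) → Unique is →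
            (∀ {i} → i ∈ is → HasSize (Q i) (f i)) →
            HasSize (λ (i , b) → i ∈ is × Q i b) (sum (List.map f is))
HasSize-Σ {is = []} f [] sz = HasSize-∅ (λ ())
HasSize-Σ {I} {B} {is = i ∷ is} {Q} f (i∉ ∷ u) sz =
  HasSize-⇔ [ (λ { (refl , q) → here refl , q }) , (λ (j∈ , q) → there j∈ , q) ]′
            (λ { (here refl , q) → inj₁ (refl , q) ; (there j∈ , q) → inj₂ (j∈ , q) })
    (HasSize-⊎ (λ { (refl , _) (i∈ , _) → All.lookup i∉ i∈ refl })
      (HasSize-bij {Q = λ (j , b) → i ≡ j × Q j b} (i ,_) (λ q → refl , q) (λ { _ _ refl → refl })
        (λ { {(_ , b)} (refl , q) → b , q , refl }) (sz (here refl)))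
      (HasSize-Σ f u (sz ∘ there)))

sum-map-const : {A : Set} (c : ℕ) (xs : List A) → sum (List.map (λ _ → c) xs) ≡ length xs * c
sum-map-const c []       = refl
sum-map-const c (x ∷ xs) = cong (_+_ c) (sum-map-const c xs)

HasSize-×-const : {A B : Set} {P : A → Set} {Q : A → B → Set} {p q : ℕ} →
                  HasSize P p → (∀ {x} → P x → HasSize (Q x) q) →
                  HasSize (λ (x , y) → P x × Q x y) (p * q)
HasSize-×-const {P = P} {Q} {q = q} (xs , u , p , refl) sz =
  HasSize-⇔ (λ (x∈ , qq) → to (p _) x∈ , qq) (λ (px , qq) → from (p _) px , qq)
    (subst (HasSize _) (sum-map-const q xs) (HasSize-Σ (λ _ → q) u (λ x∈ → sz (to (p _) x∈))))

HasSize-Fin : (n : ℕ) → HasSize {Fin n} (λ _ → ⊤) n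
HasSize-Fin n = List.allFin n , Uniqueₚ.allFin⁺ n , (λ x → mk⇔ _ (λ _ → ∈-allFin x)) ,
                Listₚ.length-tabulate id

HasSize-Vec : (k n : ℕ) → HasSize {Vec (Fin k) n} (λ _ → ⊤) (k ^ n)
HasSize-Vec k zero    = [] ∷ [] , [] ∷ [] , (λ { [] → mk⇔ _ (λ _ → here refl) }) , refl
HasSize-Vec k (suc n) =
  HasSize-bij (λ (x , v) → x ∷ v) _ (λ { _ _ refl → refl }) (λ { {x ∷ v} _ → (x , v) , _ , refl })
    (HasSize-×-const (HasSize-Fin k) (λ _ → HasSize-Vec k n))

HasSize-∃ : {A : Set} {P : A → Set} {m : ℕ} → HasSize P m → 0 < m → ∃ P
HasSize-∃ ([] , u , p , refl) ()
HasSize-∃ (x ∷ xs , u , p , eq) _ = x , to (p x) (here refl)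

HasSize-0 : {A : Set} {P : A → Set} → HasSize P 0 → ∀ {x} → ¬ P x
HasSize-0 ([] , _ , p , _) px with () ← from (p _) px

-- Labellings compatible with the descents of a permutation

nextBound : ∀ {N m} → Fin N → Vec (Fin N) m → ℕ → ℕ
nextBound t []       a = a
nextBound t (t′ ∷ _) a = if does (t′ Fin.<? t) then suc a else a

-- The local form of the labelling condition: `l` bounds the first label from below, and each later
-- bound is the preceding label, raised by one at a descent. Only neighbours are compared, which
-- makes a recursive count possible.
Labels : ∀ {N k m} → ℕ → Vec (Fin N) m → Vec (Fin k) m → Set
Labels l []       []       = ⊤
Labels l (t ∷ ts) (a ∷ as) = l ≤ toℕ a × Labels (nextBound t ts (toℕ a)) ts as

-- Truncation does no harm: for d > X every upper number is 0, and all the lower ones are positive.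
pascal-∸ : ∀ X d m → (X ∸ d) C suc m + (X ∸ d) C suc (suc m) ≡ (suc X ∸ d) C suc (suc m)
pascal-∸ X d m with d ℕ.≤? X
... | yes d≤X = trans (nCk+nC[k+1]≡[n+1]C[k+1] (X ∸ d) (suc m))
                      (cong (_C suc (suc m)) (sym (ℕₚ.+-∸-assoc 1 d≤X)))
... | no  d≰X = begin
  (X ∸ d) C suc m + (X ∸ d) C suc (suc m) ≡⟨ cong (λ z → z C suc m + z C suc (suc m)) X∸d≡0 ⟩
  0 C suc m + 0 C suc (suc m)             ≡⟨⟩
  0                                       ≡⟨⟩
  0 C suc (suc m)                         ≡⟨ cong (_C suc (suc m)) (ℕₚ.m≤n⇒m∸n≡0 (ℕₚ.≰⇒> d≰X)) ⟨
  (suc X ∸ d) C suc (suc m)               ∎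
  where
  open ≡-Reasoning
  X∸d≡0 : X ∸ d ≡ 0
  X∸d≡0 = ℕₚ.m≤n⇒m∸n≡0 (ℕₚ.≰⇒≥ d≰X)

-- Pascal's rule, according to whether the first label is l or larger.
Labels-size : ∀ {N k} m l r → l + r ≡ k → (ts : Vec (Fin N) (suc m)) →
              HasSize (Labels {k = k} l ts) ((m + r ∸ descentsL (toList ts)) C suc m)
Labels-size {k = k} m l zero eq ts@(_ ∷ _) =
  subst (HasSize _) (sym (k>n⇒nCk≡0 (s≤s (ℕₚ.≤-trans (ℕₚ.m∸n≤m (m + 0) (descentsL (toList ts))) (ℕₚ.≤-reflexive (ℕₚ.+-identityʳ m))))))
    (HasSize-∅ λ { {a ∷ as} (l≤a , _) →
      ℕₚ.<⇒≱ (toℕ<n a) (subst (_≤ toℕ a) (trans (sym (ℕₚ.+-identityʳ l)) eq) l≤a) })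
Labels-size {k = k} m l (suc r) eq (t ∷ ts) =
  subst (HasSize _) (size m ts .proj₂)
    (HasSize-⇔ merge split
      (HasSize-⊎ disj
        (HasSize-bij {Q = First} (l′ ∷_)
          (λ ok → refl , subst (λ z → Labels (nextBound t ts z) ts _) (sym l′≡l) ok)
          (λ { _ _ refl → refl })
          (λ { {_ ∷ v} (refl , ok) → v , subst (λ z → Labels (nextBound t ts z) ts _) l′≡l ok , refl })
          (size m ts .proj₁ .proj₂))
        (Labels-size m (suc l) r (trans (sym (ℕₚ.+-suc l r)) eq) (t ∷ ts))))
  where
  l<k : l < k
  l<k = subst (l <_) eq (ℕₚ.m<m+n l ℕ.z<s)
  l′ : Fin k
  l′ = fromℕ< l<k
  l′≡l : toℕ l′ ≡ l
  l′≡l = toℕ-fromℕ< l<k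
  First : Vec (Fin k) (suc m) → Set
  First (a ∷ as) = a ≡ l′ × Labels (nextBound t ts (toℕ a)) ts as
  disj : ∀ {v} → First v → ¬ Labels (suc l) (t ∷ ts) v
  disj {_ ∷ _} (refl , _) (sl≤ , _) = ℕₚ.n≮n l (subst (l <_) l′≡l sl≤)
  merge : ∀ {v} → First v ⊎ Labels (suc l) (t ∷ ts) v → Labels l (t ∷ ts) v
  merge {_ ∷ _} (inj₁ (refl , ok)) = ℕₚ.≤-reflexive (sym l′≡l) , ok
  merge {_ ∷ _} (inj₂ (sl≤ , ok)) = ℕₚ.<⇒≤ sl≤ , ok
  split : ∀ {v} → Labels l (t ∷ ts) v → First v ⊎ Labels (suc l) (t ∷ ts) v
  split {_ ∷ _} (l≤ , ok) with ℕₚ.m≤n⇒m<n∨m≡n l≤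
  ... | inj₁ l<  = inj₂ (l< , ok)
  ... | inj₂ l≡a = inj₁ (toℕ-injective (trans (sym l≡a) (sym l′≡l)) , ok)
  size : ∀ m (ts : Vec (Fin _) m) →
         Σ (∃ λ s → HasSize (Labels {k = k} (nextBound t ts l) ts) s)
           λ (s , _) → s + (m + r ∸ descentsL (toList (t ∷ ts))) C suc m
                       ≡ (m + suc r ∸ descentsL (toList (t ∷ ts))) C suc m
  size zero [] = (1 , HasSize-bij (λ _ → []) _ (λ { {[]} {[]} _ _ _ → refl })
                        (λ { {[]} _ → [] , _ , refl }) (HasSize-Vec k 0)) ,
                 trans (cong suc (nC1≡n r)) (sym (nC1≡n (suc r)))
  size (suc m) (t′ ∷ ts) with t′ Fin.<? t
  -- A descent starts the tail at `suc l`, with `r` letters left, and the tail has one descent fewer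
  -- than the whole; otherwise the tail keeps the bound `l` and all descents. Both cases are
  -- `pascal-∸`, at m + r and at m + r + 1.
  ... | yes p rewrite dec-true (t′ Fin.<? t) p = (_ , Labels-size m (suc l) r (trans (sym (ℕₚ.+-suc l r)) eq) (t′ ∷ ts)) ,
                trans (pascal-∸ (m + r) d m)
                  (cong (λ z → (z ∸ d) C suc (suc m)) (sym (ℕₚ.+-suc m r)))
    where d = descentsL (toList (t′ ∷ ts))
  ... | no ¬p rewrite dec-false (t′ Fin.<? t) ¬p =
                (_ , Labels-size m l (suc r) eq (t′ ∷ ts)) ,
                trans (cong (λ z → (z ∸ d) C suc m + (suc (m + r) ∸ d) C suc (suc m)) (ℕₚ.+-suc m r))
                  (trans (pascal-∸ (suc (m + r)) d m)
                    (cong (λ z → (suc z ∸ d) C suc (suc m)) (sym (ℕₚ.+-suc m r))))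
    where d = descentsL (toList (t′ ∷ ts))

-- The global form of the condition, for all pairs of positions. The second component is what keeps
-- two itineraries in order past a common letter.
Compatible : ∀ {N k m} → Vec (Fin N) m → Vec (Fin k) m → Set
Compatible ts as = ∀ p q → p Fin.< q → lookup as p Fin.≤ lookup as q ×
  (lookup as p ≡ lookup as q → lookup ts p Fin.≤ lookup ts q)

-- A descent pushes every later label above `l`. So if the label at `q` still equals `l`, there is
-- no descent on the way to `q`, and the entries of `ts` have only grown.
Labels⇒≤ : ∀ {N k m} (l : ℕ) (t : Fin N) (ts : Vec (Fin N) m) (as : Vec (Fin k) m) →
           Labels (nextBound t ts l) ts as →
           ∀ q → l ≤ toℕ (lookup as q) × (l ≡ toℕ (lookup as q) → t Fin.≤ lookup ts q)
Labels⇒≤ l t (t′ ∷ ts) (a′ ∷ as) (l≤a′ , ok) q with t′ Fin.<? t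
... | yes p rewrite dec-true (t′ Fin.<? t) p =
  ℕₚ.<⇒≤ l<aq , λ eq → contradiction eq (ℕₚ.<⇒≢ l<aq)
  where
  l<aq : l < toℕ (lookup (a′ ∷ as) q)
  l<aq = ℕₚ.<-≤-trans l≤a′ (a′≤ q)
    where
    a′≤ : ∀ q → a′ Fin.≤ lookup (a′ ∷ as) q
    a′≤ zero    = ℕₚ.≤-refl
    a′≤ (suc q) = proj₁ (Labels⇒≤ (toℕ a′) t′ ts as ok q)
Labels⇒≤ l t (t′ ∷ ts) (a′ ∷ as) (l≤a′ , ok) zero    | no ¬p
  rewrite dec-false (t′ Fin.<? t) ¬p = l≤a′ , λ _ → ℕₚ.≮⇒≥ ¬p
Labels⇒≤ l t (t′ ∷ ts) (a′ ∷ as) (l≤a′ , ok) (suc q) | no ¬p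
  rewrite dec-false (t′ Fin.<? t) ¬p =
  let (a′≤aq , rest) = Labels⇒≤ (toℕ a′) t′ ts as ok q in
  ℕₚ.≤-trans l≤a′ a′≤aq ,
  λ eq → ℕₚ.≤-trans (ℕₚ.≮⇒≥ ¬p) (rest (ℕₚ.≤-antisym a′≤aq (subst (_≤ toℕ a′) eq l≤a′)))

Labels⇒Compatible : ∀ {N k m} l (ts : Vec (Fin N) m) (as : Vec (Fin k) m) →
                    Labels l ts as → Compatible ts as
Labels⇒Compatible l (t ∷ ts) (a ∷ as) (_ , ok) zero    (suc q) _         =
  let (≤q , =q) = Labels⇒≤ (toℕ a) t ts as ok q in ≤q , =q ∘ cong toℕ
Labels⇒Compatible l (t ∷ ts) (a ∷ as) (_ , ok) (suc p) (suc q) (s≤s p<q) =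
  Labels⇒Compatible _ ts as ok p q p<q

Compatible⇒Labels : ∀ {N k m} l (ts : Vec (Fin N) m) (as : Vec (Fin k) m) →
                    (∀ q → l ≤ toℕ (lookup as q)) → Compatible ts as → Labels l ts as
Compatible⇒Labels l []       []       l≤ c = tt
Compatible⇒Labels l (t ∷ ts) (a ∷ as) l≤ c = l≤ zero ,
  Compatible⇒Labels _ ts as (bound ts as c) (λ p q p<q → c (suc p) (suc q) (s≤s p<q))
  where
  bound : ∀ {m} (ts : Vec (Fin _) m) (as : Vec (Fin _) m) → Compatible (t ∷ ts) (a ∷ as) →
          ∀ q → nextBound t ts (toℕ a) ≤ toℕ (lookup as q)
  bound (t′ ∷ ts) (a′ ∷ as) c q with t′ Fin.<? t
  ... | no ¬p rewrite dec-false (t′ Fin.<? t) ¬p = proj₁ (c zero (suc q) ℕ.z<s)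
  ... | yes t′<t rewrite dec-true (t′ Fin.<? t) t′<t = ℕₚ.<-≤-trans
    (ℕₚ.≤∧≢⇒< (proj₁ (c zero (suc zero) ℕ.z<s))
      (λ a≡a′ → ℕₚ.<⇒≱ t′<t (proj₂ (c zero (suc zero) ℕ.z<s) (toℕ-injective a≡a′))))
    (mono q)
    where
    mono : ∀ q → a′ Fin.≤ lookup (a′ ∷ as) q
    mono zero    = ℕₚ.≤-refl
    mono (suc q) = proj₁ (c (suc zero) (suc (suc q)) (s≤s ℕ.z<s))

-- Periods, the lexicographic order and rankings

Period : {A : Set} → (ℕ → A) → ℕ → Set
Period s e = ∀ i → s (e + i) ≡ s i

module _ {A : Set} {s : ℕ → A} where

  Period-* : ∀ {e} c → Period s e → Period s (c * e)
  Period-* zero    p i = refl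
  Period-* {e} (suc c) p i = trans (cong s (ℕₚ.+-assoc e (c * e) i)) (trans (p _) (Period-* c p i))

  Period-% : ∀ {e} .{{_ : NonZero e}} → Period s e → ∀ i → s i ≡ s (i % e)
  Period-% {e} p i = begin
    s i                             ≡⟨ cong s (m≡m%n+[m/n]*n i e) ⟩
    s (i % e + (i ℕ./ e) * e)       ≡⟨ cong s (ℕₚ.+-comm (i % e) _) ⟩
    s ((i ℕ./ e) * e + i % e)       ≡⟨ Period-* (i ℕ./ e) p (i % e) ⟩
    s (i % e)                       ∎
    where open ≡-Reasoning

Period-shift : {A : Set} {s : ℕ → A} {e : ℕ} → Period s e → ∀ c → Period (λ m → s (c + m)) e
Period-shift {s = s} {e} p c i = trans (cong s (begin
  c + (e + i) ≡⟨ ℕₚ.+-assoc c e i ⟨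
  c + e + i   ≡⟨ cong (_+ i) (ℕₚ.+-comm c e) ⟩
  e + c + i   ≡⟨ ℕₚ.+-assoc e c i ⟩
  e + (c + i) ∎)) (p (c + i))
  where open ≡-Reasoning

toℕ-% : ∀ i {n} .{{_ : NonZero n}} → toℕ (i mod n) ≡ i % n
toℕ-% i {n} = toℕ-fromℕ< (m%n<n i n)

-- The known period `n` reduces the infinitely many equations to the indices below `n`.
Period? : {A : Set} (_≟_ : (x y : A) → Dec (x ≡ y)) {s : ℕ → A} {n : ℕ} .{{_ : NonZero n}} →
          Period s n → ∀ e → Dec (Period s e)
Period? _≟_ {s} {n} p e = map′ extend (λ q i → q (toℕ i))
  (Finₚ.all? {n} (λ i → s (e + toℕ i) ≟ s (toℕ i)))
  where
  open ≡-Reasoning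
  extend : (∀ (i : Fin n) → s (e + toℕ i) ≡ s (toℕ i)) → Period s e
  extend q i = begin
    s (e + i)               ≡⟨ Period-% (Period-shift p e) i ⟩
    s (e + i % n)           ≡⟨ cong (λ z → s (e + z)) (toℕ-% i) ⟨
    s (e + toℕ (i mod n))   ≡⟨ q (i mod n) ⟩
    s (toℕ (i mod n))       ≡⟨ cong s (toℕ-% i) ⟩
    s (i % n)               ≡⟨ Period-% p i ⟨
    s i                     ∎

least : {P : ℕ → Set} → Decidable P → ∀ n → P n → ∃ λ m → P m × (∀ j → j < m → ¬ P j)
least P? zero    p = zero , p , λ _ ()
least {P} P? (suc n) p with P? zero
... | yes p₀ = zero , p₀ , λ _ ()
... | no ¬p₀ with least (P? ∘ suc) n p
... | m , q , min = suc m , q , λ { zero _ → ¬p₀ ; (suc j) (s≤s j<m) → min j j<m }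

-- The remainder of a period modulo the least positive one is again a period, hence zero by
-- minimality. The search runs over e + 1, as zero is always a `Period`.
leastPeriod : {A : Set} (_≟_ : (x y : A) → Dec (x ≡ y)) {s : ℕ → A} {n : ℕ} .{{_ : NonZero n}} →
              Period s n → ∃ λ m → Period s (suc m) × (∀ e → Period s e → suc m ∣ e)
leastPeriod _≟_ {s} {n@(suc n-1)} p with least (λ e → Period? _≟_ p (suc e)) n-1 p
... | m , q , min = m , q , dvd
  where
  open ≡-Reasoning
  rem : ∀ e → Period s e → Period s (e % suc m)
  rem e pe i = begin
    s (e % suc m + i)                             ≡⟨ Period-* (e ℕ./ suc m) q _ ⟨
    s ((e ℕ./ suc m) * suc m + (e % suc m + i))   ≡⟨ cong s (ℕₚ.+-assoc ((e ℕ./ suc m) * suc m) (e % suc m) i) ⟨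
    s ((e ℕ./ suc m) * suc m + e % suc m + i)     ≡⟨ cong (λ z → s (z + i)) (ℕₚ.+-comm ((e ℕ./ suc m) * suc m) (e % suc m)) ⟩
    s (e % suc m + (e ℕ./ suc m) * suc m + i)     ≡⟨ cong (λ z → s (z + i)) (m≡m%n+[m/n]*n e (suc m)) ⟨
    s (e + i)                                     ≡⟨ pe i ⟩
    s i                                           ∎
  dvd : ∀ e → Period s e → suc m ∣ e
  dvd e pe with e % suc m in eq
  ... | zero  = Div.m%n≡0⇒n∣m e (suc m) eq
  ... | suc r = contradiction (subst (Period s) eq (rem e pe))
                  (min r (ℕ.s≤s⁻¹ (subst (_< suc m) eq (m%n<n e (suc m)))))

mod-cong : ∀ i j {n} .{{_ : NonZero n}} → i % n ≡ j % n → i mod n ≡ j mod n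
mod-cong i j {n} eq = toℕ-injective
  (trans (toℕ-% i) (trans eq (sym (toℕ-% j))))

toℕ-mod : ∀ {n} .{{_ : NonZero n}} (i : Fin n) → toℕ i mod n ≡ i
toℕ-mod {n} i = toℕ-injective (trans (toℕ-% (toℕ i)) (m<n⇒m%n≡m (toℕ<n i)))

module _ {k n : ℕ} .{{_ : NonZero n}} (w : Vec (Fin k) n) where

  periodic-toℕ : ∀ i → periodic w (toℕ i) ≡ lookup w i
  periodic-toℕ i = cong (lookup w) (toℕ-mod i)

  periodic-period : Period (periodic w) n
  periodic-period i = cong (lookup w) (mod-cong (n + i) i (trans (cong (_% n) (ℕₚ.+-comm n i)) (DivMod.[m+n]%n≡m%n i n)))

  -- As `suc d` divides `n`, the jump of w^∞ back to the start of `w` falls at the start of a copy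
  -- of `u`: reducing modulo `n` first does not change the residue modulo `suc d`.
  power⇒period : ∀ {d} → suc d ∣ n → (u : Vec (Fin k) (suc d)) →
                 (∀ i → lookup w i ≡ lookup u (toℕ i mod suc d)) → Period (periodic w) (suc d)
  power⇒period {d} d∣n u eq i = trans (unfold (suc d + i)) (trans (periodᵤ i) (sym (unfold i)))
    where
    open ≡-Reasoning
    unfold : ∀ m → periodic w m ≡ lookup u (m mod suc d)
    unfold m = trans (eq (m mod n)) (cong (lookup u) (mod-cong (toℕ (m mod n)) m (begin
      toℕ (m mod n) % suc d ≡⟨ cong (_% suc d) (toℕ-% m) ⟩
      m % n % suc d         ≡⟨ m∣n⇒o%n%m≡o%m (suc d) n m d∣n ⟩
      m % suc d             ∎)))
    periodᵤ : ∀ i → lookup u ((suc d + i) mod suc d) ≡ lookup u (i mod suc d)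
    periodᵤ i = cong (lookup u) (mod-cong (suc d + i) i
      (trans (cong (_% suc d) (ℕₚ.+-comm (suc d) i)) (DivMod.[m+n]%n≡m%n i (suc d))))

  period⇒power : ∀ {d} → Period (periodic w) (suc d) →
                 ∃ λ (u : Vec (Fin k) (suc d)) → ∀ i → lookup w i ≡ lookup u (toℕ i mod suc d)
  period⇒power {d} p = tabulate (periodic w ∘ toℕ) , λ i → begin
    lookup w i                                         ≡⟨ periodic-toℕ i ⟨
    periodic w (toℕ i)                                 ≡⟨ Period-% p (toℕ i) ⟩
    periodic w (toℕ i % suc d)                         ≡⟨ cong (periodic w) (toℕ-% (toℕ i)) ⟨
    periodic w (toℕ (toℕ i mod suc d))                 ≡⟨ lookup∘tabulate (periodic w ∘ toℕ) (toℕ i mod suc d) ⟨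
    lookup (tabulate (periodic w ∘ toℕ)) (toℕ i mod suc d) ∎
    where open ≡-Reasoning

  -- The least period divides `n`, and a value below `n` would exhibit `w` as a power.
  primitive⇒n∣period : Primitive w → ∀ e → Period (periodic w) e → n ∣ e
  primitive⇒n∣period prim e pe with leastPeriod Fin._≟_ periodic-period
  ... | m , pm , min with suc m ℕ.<? n
  ... | yes m<n = contradiction (m , m<n , min n periodic-period , period⇒power pm) prim
  ... | no  m≮n = subst (_∣ e) (ℕₚ.≤-antisym (Div.∣⇒≤ (min n periodic-period)) (ℕₚ.≮⇒≥ m≮n)) (min e pe)

-- The order of the k-shift without its parity bookkeeping: with all signs plus, `negCount` is 0 and
-- the order is the plain lexicographic one.
_⊰_ : {k : ℕ} → Word k → Word k → Set
s ⊰ t = ∃ λ j → (∀ i → i < j → s i ≡ t i) × s j Fin.< t j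

negCount-allPlus : ∀ k (s : Word k) j → negCount (allPlus k) s j ≡ 0
negCount-allPlus k s zero    = refl
negCount-allPlus k s (suc j) = trans (ℕₚ.+-identityʳ _) (negCount-allPlus k s j)

module _ {k : ℕ} {s t : Word k} where

  ≺⇒⊰ : s ≺⟨ allPlus k ⟩ t → s ⊰ t
  ≺⇒⊰ (j , agree , lt) rewrite negCount-allPlus k s j = j , agree , lt

  ⊰⇒≺ : s ⊰ t → s ≺⟨ allPlus k ⟩ t
  ⊰⇒≺ (j , agree , lt) = j , agree ,
    subst (λ c → if evenᵇ c then s j Fin.< t j else t j Fin.< s j) (sym (negCount-allPlus k s j)) lt

module _ {k : ℕ} {s t : Word k} where

  ⊰-resp : {s′ t′ : Word k} → s ≗ s′ → t ≗ t′ → s ⊰ t → s′ ⊰ t′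
  ⊰-resp p q (j , agree , lt) = j ,
    (λ i i<j → trans (sym (p i)) (trans (agree i i<j) (q i))) ,
    subst₂ Fin._<_ (p j) (q j) lt

  ⊰-irrefl : s ≗ t → ¬ s ⊰ t
  ⊰-irrefl s≗t (j , _ , lt) = ℕₚ.<⇒≢ lt (cong toℕ (s≗t j))

  -- Equality of infinite words is not decidable, so the search for a difference stops at a bound
  -- `N`; the callers supply a bound up to which the words cannot agree.
  firstDiff : ∀ N → (∀ i → i < N → s i ≡ t i) ⊎
                    (∃ λ j → j < N × (∀ i → i < j → s i ≡ t i) × s j ≢ t j)
  firstDiff zero = inj₁ λ _ ()
  firstDiff (suc N) with firstDiff N
  ... | inj₂ (j , j<N , d) = inj₂ (j , ℕₚ.m<n⇒m<1+n j<N , d)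
  ... | inj₁ agree with s N Fin.≟ t N
  ... | no ≢N = inj₂ (N , ℕₚ.≤-refl , agree , ≢N)
  ... | yes ≡N = inj₁ λ i i<1+N → [ agree i , (λ { refl → ≡N }) ]′ (ℕₚ.m<1+n⇒m<n∨m≡n i<1+N)

⊰-trans : {k : ℕ} {s t u : Word k} → s ⊰ t → t ⊰ u → s ⊰ u
⊰-trans {s = s} {t} {u} (j , agree , lt) (j′ , agree′ , lt′) with ℕₚ.<-cmp j j′
... | tri< j<j′ _ _ = j , (λ i i<j → trans (agree i i<j) (agree′ i (ℕₚ.<-trans i<j j<j′))) ,
                      subst (s j Fin.<_) (agree′ j j<j′) lt
... | tri≈ _ refl _ = j , (λ i i<j → trans (agree i i<j) (agree′ i i<j)) , ℕₚ.<-trans lt lt′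
... | tri> _ _ j>j′ = j′ , (λ i i<j′ → trans (agree i (ℕₚ.<-trans i<j′ j>j′)) (agree′ i i<j′)) ,
                      subst (Fin._< u j′) (sym (agree j′ j>j′)) lt′

⊰-asym : {k : ℕ} {s t : Word k} → s ⊰ t → ¬ t ⊰ s
⊰-asym p q = ⊰-irrefl (λ _ → refl) (⊰-trans p q)

module _ {k : ℕ} {s t : Word k} where

  ≢⇒⊰ : ∀ {j} → (∀ i → i < j → s i ≡ t i) → s j ≢ t j → s ⊰ t ⊎ t ⊰ s
  ≢⇒⊰ {j} agree ≢j with Finₚ.<-cmp (s j) (t j)
  ... | tri< lt _ _ = inj₁ (j , agree , lt)
  ... | tri≈ _ eq _ = contradiction eq ≢j
  ... | tri> _ _ gt = inj₂ (j , (λ i i<j → sym (agree i i<j)) , gt)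

-- Permutations determined by their order

-- A missed value could be punched out of the codomain, leaving an injection into a smaller `Fin`.
injective⇒surjective : ∀ {n} (f : Fin n → Fin n) → (∀ i j → f i ≡ f j → i ≡ j) → ∀ y → ∃ λ x → f x ≡ y
injective⇒surjective {suc n} f inj y with Finₚ.any? (λ x → f x Fin.≟ y)
... | yes p = p
... | no ¬p = contradiction
  (Finₚ.injective⇒≤ {f = λ x → Fin.punchOut (λ y≡fx → ¬p (x , sym y≡fx))}
    (λ {x} {x′} eq → inj x x′ (Finₚ.punchOut-injective (λ y≡ → ¬p (x , sym y≡)) (λ y≡ → ¬p (x′ , sym y≡)) eq)))
  ℕₚ.1+n≰n

increasing⇒inflationary : ∀ {n} (h : Fin n → Fin n) → (∀ {y z} → y Fin.< z → h y Fin.< h z) →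
                          ∀ m (m<n : m < n) → m ≤ toℕ (h (fromℕ< m<n))
increasing⇒inflationary h mono zero    m<n = z≤n
increasing⇒inflationary h mono (suc m) m<n =
  ℕₚ.≤-<-trans (increasing⇒inflationary h mono m (ℕₚ.<⇒≤ m<n))
    (mono (subst₂ _<_ (sym (toℕ-fromℕ< (ℕₚ.<⇒≤ m<n))) (sym (toℕ-fromℕ< m<n)) (ℕₚ.n<1+n m)))

-- The map `ρ` after the inverse of `π` is strictly increasing on `Fin n`, so it never decreases a
-- value. With the roles exchanged this gives equality.
sameOrder⇒≤ : ∀ {n} (π ρ : Vec (Fin n) n) → IsPerm π →
              (∀ i j → lookup π i Fin.< lookup π j → lookup ρ i Fin.< lookup ρ j) →
              ∀ i → lookup π i Fin.≤ lookup ρ i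
sameOrder⇒≤ {n} π ρ perm order i = subst₂ Fin._≤_ refl (cong (lookup ρ) (perm _ _ (proj₂ (π⁻¹ (lookup π i)))))
  (subst (λ z → toℕ (lookup π i) ≤ toℕ (h z)) (Finₚ.fromℕ<-toℕ (lookup π i) (toℕ<n (lookup π i)))
    (increasing⇒inflationary h
      (λ {y} {z} y<z → order _ _ (subst₂ Fin._<_ (sym (proj₂ (π⁻¹ y))) (sym (proj₂ (π⁻¹ z))) y<z))
      (toℕ (lookup π i)) (toℕ<n (lookup π i))))
  where
  π⁻¹ = injective⇒surjective (lookup π) perm
  h : Fin n → Fin n
  h y = lookup ρ (proj₁ (π⁻¹ y))

Vec-ext : ∀ {A : Set} {n} {u v : Vec A n} → (∀ i → lookup u i ≡ lookup v i) → u ≡ v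
Vec-ext {u = u} {v} eq = trans (sym (Vecₚ.tabulate∘lookup u))
  (trans (Vecₚ.tabulate-cong eq) (Vecₚ.tabulate∘lookup v))

sameOrder⇒≡ : ∀ {n} (π ρ : Vec (Fin n) n) → IsPerm π → IsPerm ρ →
              (∀ i j → lookup π i Fin.< lookup π j ⇔ lookup ρ i Fin.< lookup ρ j) → π ≡ ρ
sameOrder⇒≡ π ρ pπ pρ order = Vec-ext λ i → Finₚ.≤-antisym
  (sameOrder⇒≤ π ρ pπ (λ i j → to (order i j)) i)
  (sameOrder⇒≤ ρ π pρ (λ i j → from (order i j)) i)

module _ {A : Set} {P Q : A → Set} (P? : Decidable P) (Q? : Decidable Q) (P⊆Q : ∀ {x} → P x → Q x) where

  length-filter-≤ : ∀ xs → length (filter P? xs) ≤ length (filter Q? xs)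
  length-filter-≤ [] = z≤n
  length-filter-≤ (x ∷ xs) with P? x | Q? x
  ... | yes p | yes q = s≤s (length-filter-≤ xs)
  ... | yes p | no ¬q = contradiction (P⊆Q p) ¬q
  ... | no ¬p | yes q = ℕₚ.m≤n⇒m≤1+n (length-filter-≤ xs)
  ... | no ¬p | no ¬q = length-filter-≤ xs

  length-filter-< : ∀ {x xs} → x ∈ xs → ¬ P x → Q x → length (filter P? xs) < length (filter Q? xs)
  length-filter-< {x} {_ ∷ xs} (here refl) ¬p q with P? x | Q? x
  ... | yes p | _     = contradiction p ¬p
  ... | no _  | yes _ = s≤s (length-filter-≤ xs)
  ... | no _  | no ¬q = contradiction q ¬q
  length-filter-< {x} {y ∷ xs} (there x∈) ¬p q with P? y | Q? y
  ... | yes p | yes _ = s≤s (length-filter-< x∈ ¬p q)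
  ... | yes p | no ¬q = contradiction (P⊆Q p) ¬q
  ... | no _  | yes _ = ℕₚ.m<n⇒m<1+n (length-filter-< x∈ ¬p q)
  ... | no _  | no _  = length-filter-< x∈ ¬p q

module _ {n : ℕ} {_◁_ : Fin n → Fin n → Set} (_◁?_ : ∀ i j → Dec (i ◁ j))
         (◁-irrefl : ∀ {i} → ¬ i ◁ i) (◁-trans : ∀ {i j l} → i ◁ j → j ◁ l → i ◁ l)
         (◁-conn : ∀ i j → i ≢ j → i ◁ j ⊎ j ◁ i) where

  private
    below : Fin n → ℕ
    below i = length (filter (_◁? i) (List.allFin n))

    below<n : ∀ i → below i < n
    below<n i = subst (below i <_) (Listₚ.length-tabulate id)
      (Listₚ.filter-notAll (_◁? i) (List.allFin n) (lose (∈-allFin i) ◁-irrefl))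

    below-mono : ∀ {i j} → i ◁ j → below i < below j
    below-mono {i} {j} i◁j =
      length-filter-< (_◁? i) (_◁? j) (λ x◁i → ◁-trans x◁i i◁j) (∈-allFin i) ◁-irrefl i◁j

    rankVec : Vec (Fin n) n
    rankVec = tabulate (λ i → fromℕ< (below<n i))

    toℕ-rank : ∀ i → toℕ (lookup rankVec i) ≡ below i
    toℕ-rank i = trans (cong toℕ (lookup∘tabulate _ i)) (toℕ-fromℕ< (below<n i))

    rank-mono : ∀ {i j} → i ◁ j → lookup rankVec i Fin.< lookup rankVec j
    rank-mono {i} {j} i◁j = subst₂ _<_ (sym (toℕ-rank i)) (sym (toℕ-rank j)) (below-mono i◁j)

  -- The rank of `i` is the number of elements below it. For i ◁ j the elements below `i` are below
  -- `j`, and `i` itself is counted only for `j`, so ranks grow strictly.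
  ranking : ∃ λ (π : Vec (Fin n) n) → IsPerm π × (∀ i j → lookup π i Fin.< lookup π j ⇔ i ◁ j)
  ranking = rankVec , perm , λ i j → mk⇔ (reflect i j) rank-mono
    where
    perm : IsPerm rankVec
    perm i j eq with i Fin.≟ j
    ... | yes i≡j = i≡j
    ... | no  i≢j = ⊥-elim ([ (λ r → ℕₚ.<⇒≢ (rank-mono r) (cong toℕ eq)) ,
                              (λ r → ℕₚ.<⇒≢ (rank-mono r) (cong toℕ (sym eq))) ]′ (◁-conn i j i≢j))
    reflect : ∀ i j → lookup rankVec i Fin.< lookup rankVec j → i ◁ j
    reflect i j lt with i Fin.≟ j
    ... | yes refl = contradiction lt (ℕₚ.n≮n _)
    ... | no  i≢j  = [ id , (λ r → contradiction lt (ℕₚ.<-asym (rank-mono r))) ]′ (◁-conn i j i≢j)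

-- Words coded by cyclic permutations

module _ {n : ℕ} (τ : Vec (Fin n) n) where

  iter-+ : ∀ i j x → iter τ (i + j) x ≡ iter τ i (iter τ j x)
  iter-+ zero    j x = refl
  iter-+ (suc i) j x = cong (lookup τ) (iter-+ i j x)

  iter-injective : IsPerm τ → ∀ i {x y} → iter τ i x ≡ iter τ i y → x ≡ y
  iter-injective perm zero    eq = eq
  iter-injective perm (suc i) eq = iter-injective perm i (perm _ _ eq)

  iter-period : ∀ d {x} → iter τ d x ≡ x → Period (λ i → iter τ i x) d
  iter-period d {x} eq i = begin
    iter τ (d + i) x        ≡⟨ cong (λ z → iter τ z x) (ℕₚ.+-comm d i) ⟩
    iter τ (i + d) x        ≡⟨ iter-+ i d x ⟩
    iter τ i (iter τ d x)   ≡⟨ cong (iter τ i) eq ⟩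
    iter τ i x              ∎
    where open ≡-Reasoning

module _ {n : ℕ} {τ : Vec (Fin n) n} (cyc : IsCyclic τ) where

  private
    perm : IsPerm τ
    perm = proj₁ cyc

    reachable : ∀ x y → ∃ λ j → iter τ j x ≡ y
    reachable = proj₂ cyc

  -- If `x` returns after `d` steps, every point is reached from `x` at a time reduced modulo `d`,
  -- and these times inject `Fin n` into `Fin d`.
  returnTime≥n : ∀ {d x} → 0 < d → iter τ d x ≡ x → n ≤ d
  returnTime≥n {d@(suc _)} {x} _ eq =
    Finₚ.injective⇒≤ {f = λ y → proj₁ (reachable x y) mod d} (λ {y} {y′} e → begin
      y                                  ≡⟨ reach y ⟩
      iter τ (toℕ (proj₁ (reachable x y) mod d)) x    ≡⟨ cong (λ z → iter τ (toℕ z) x) e ⟩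
      iter τ (toℕ (proj₁ (reachable x y′) mod d)) x   ≡⟨ reach y′ ⟨
      y′                                 ∎)
    where
    open ≡-Reasoning
    reach : ∀ y → y ≡ iter τ (toℕ (proj₁ (reachable x y) mod d)) x
    reach y = let j = proj₁ (reachable x y) in begin
      y                           ≡⟨ proj₂ (reachable x y) ⟨
      iter τ j x                  ≡⟨ Period-% (iter-period τ d eq) j ⟩
      iter τ (j % d) x            ≡⟨ cong (λ z → iter τ z x) (toℕ-% j) ⟨
      iter τ (toℕ (j mod d)) x    ∎

  iter-∸ : ∀ {i j x} → i ≤ j → iter τ i x ≡ iter τ j x → iter τ (j ∸ i) x ≡ x
  iter-∸ {i} {j} {x} i≤j eq = sym (iter-injective τ perm i (begin
    iter τ i x                  ≡⟨ eq ⟩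
    iter τ j x                  ≡⟨ cong (λ z → iter τ z x) (ℕₚ.m+[n∸m]≡n i≤j) ⟨
    iter τ (i + (j ∸ i)) x      ≡⟨ iter-+ τ i (j ∸ i) x ⟩
    iter τ i (iter τ (j ∸ i) x) ∎))
    where open ≡-Reasoning

  -- Among the n + 1 points at times 0 to n two coincide, which gives a return time at most `n`;
  -- `returnTime≥n` makes it equal to `n`.
  iter-n : ∀ x → iter τ n x ≡ x
  iter-n x with Finₚ.pigeonhole (ℕₚ.n<1+n n) (λ i → iter τ (toℕ i) x)
  ... | i , j , i<j , eq = subst (λ z → iter τ z x ≡ x)
    (ℕₚ.≤-antisym (ℕₚ.≤-trans (ℕₚ.m∸n≤m (toℕ j) (toℕ i)) (ℕ.s≤s⁻¹ (toℕ<n j)))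
                  (returnTime≥n (ℕₚ.m<n⇒0<n∸m i<j) back))
    back
    where back = iter-∸ (ℕₚ.<⇒≤ i<j) eq

  iter-inj-< : ∀ {i j x} → i < j → j < n → iter τ i x ≢ iter τ j x
  iter-inj-< {i} {j} i<j j<n eq = ℕₚ.<⇒≱ j<n
    (ℕₚ.≤-trans (returnTime≥n (ℕₚ.m<n⇒0<n∸m i<j) (iter-∸ (ℕₚ.<⇒≤ i<j) eq)) (ℕₚ.m∸n≤m j i))

orbit : ∀ {n} → Vec (Fin n) n → Fin n → Vec (Fin n) n
orbit τ x = tabulate (λ i → iter τ (toℕ i) x)

codeWord : ∀ {k n} → Vec (Fin n) n → Fin n → Vec (Fin k) n → Vec (Fin k) n
codeWord τ x a = tabulate (λ i → lookup a (iter τ (toℕ i) x))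

orbit-perm : ∀ {n} {τ : Vec (Fin n) n} → IsCyclic τ → ∀ x → IsPerm (orbit τ x)
orbit-perm {τ = τ} cyc x i j eq with ℕₚ.<-cmp (toℕ i) (toℕ j)
... | tri< i<j _ _ = contradiction (trans (sym (lookup∘tabulate _ i)) (trans eq (lookup∘tabulate _ j)))
                       (iter-inj-< cyc i<j (toℕ<n j))
... | tri≈ _ i≡j _ = toℕ-injective i≡j
... | tri> _ _ j<i = contradiction (trans (sym (lookup∘tabulate _ j)) (trans (sym eq) (lookup∘tabulate _ i)))
                       (iter-inj-< cyc j<i (toℕ<n i))

periodic-orbit : ∀ {n} .{{_ : NonZero n}} {τ : Vec (Fin n) n} → IsCyclic τ →
                 ∀ x m → periodic (orbit τ x) m ≡ iter τ m x
periodic-orbit {n} {τ} cyc x m = trans (lookup∘tabulate _ (m mod n))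
  (trans (cong (λ z → iter τ z x) (toℕ-% m))
    (sym (Period-% {s = λ i → iter τ i x} (iter-period τ n (iter-n cyc x)) m)))

module _ {k n : ℕ} .{{_ : NonZero n}} {τ : Vec (Fin n) n} (a : Vec (Fin k) n)
         (cyc : IsCyclic τ) (compat : Compatible τ a) where

  private
    itinerary : Fin n → Word k
    itinerary p m = lookup a (iter τ m p)

    itinerary-iter : ∀ i m x → itinerary (iter τ i x) m ≡ itinerary x (i + m)
    itinerary-iter i m x = cong (lookup a)
      (trans (sym (iter-+ τ m i x)) (cong (λ z → iter τ z x) (ℕₚ.+-comm m i)))

    -- Equal letters let compatibility carry the weak order through `τ`, and injectivity of `τ`
    -- keeps it strict.
    agree⇒iter-< : ∀ {p q} → p Fin.< q → ∀ j → (∀ i → i < j → itinerary p i ≡ itinerary q i) →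
                   iter τ j p Fin.< iter τ j q
    agree⇒iter-< p<q zero    agree = p<q
    agree⇒iter-< {p} {q} p<q (suc j) agree = ℕₚ.≤∧≢⇒<
      (proj₂ (compat _ _ ih) (agree j ℕₚ.≤-refl))
      (λ eq → ℕₚ.<⇒≢ ih (cong toℕ (proj₁ cyc _ _ (toℕ-injective eq))))
      where
      ih : iter τ j p Fin.< iter τ j q
      ih = agree⇒iter-< p<q j (λ i i<j → agree i (ℕₚ.m<n⇒m<1+n i<j))

    -- If the itineraries of p < q = τᵈ p agreed for n d steps, then p < τᵈ p < τ²ᵈ p < … < τⁿᵈ p = p.
    ¬agree : ∀ {p q} d → iter τ d p ≡ q → p Fin.< q →
             ¬ (∀ i → i < n * d → itinerary p i ≡ itinerary q i)
    ¬agree {p} {q} d τᵈp≡q p<q agree = ℕₚ.<⇒≢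
      (subst (λ z → p Fin.< iter τ (z * d) p) (ℕₚ.suc-pred n) (chain (ℕ.pred n) (ℕₚ.≤-reflexive (ℕₚ.suc-pred n))))
      (cong toℕ (sym (trans
        (cong (λ z → iter τ z p) (trans (ℕₚ.*-comm n d) (sym (ℕₚ.+-identityʳ (d * n)))))
        (Period-* {s = λ i → iter τ i p} d (iter-period τ n (iter-n cyc p)) 0))))
      where
      chain : ∀ c → c < n → p Fin.< iter τ (suc c * d) p
      chain zero    _   = subst (p Fin.<_)
        (trans (sym τᵈp≡q) (cong (λ z → iter τ z p) (sym (ℕₚ.+-identityʳ d)))) p<q
      chain (suc c) c<n = ℕₚ.<-trans (chain c (ℕₚ.<⇒≤ c<n))
        (subst (iter τ (suc c * d) p Fin.<_)
          (trans (cong (iter τ (suc c * d)) (sym τᵈp≡q))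
            (trans (sym (iter-+ τ (suc c * d) d p)) (cong (λ z → iter τ z p) (ℕₚ.+-comm (suc c * d) d))))
          (agree⇒iter-< p<q (suc c * d)
            (λ i i< → agree i (ℕₚ.<-≤-trans i< (ℕₚ.*-monoˡ-≤ d (ℕₚ.<⇒≤ c<n))))))

    -- Cyclicity provides `d` with τᵈ p = q, hence a difference within n d steps. Up to the first
    -- one the points stay in order, and there the weakly increasing labels decide the comparison.
    itinerary-mono : ∀ {p q} → p Fin.< q → itinerary p ⊰ itinerary q
    itinerary-mono {p} {q} p<q with proj₂ cyc p q
    ... | d , eq with firstDiff {s = itinerary p} {itinerary q} (n * d)
    ... | inj₁ agree = contradiction agree (¬agree d eq p<q)
    ... | inj₂ (j , _ , agree , ≢j) = j , agree ,
      ℕₚ.≤∧≢⇒< (proj₁ (compat _ _ (agree⇒iter-< p<q j agree))) (≢j ∘ toℕ-injective)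

    itinerary-reflect : ∀ {p q} → itinerary p ⊰ itinerary q → p Fin.< q
    itinerary-reflect {p} {q} lt with Finₚ.<-cmp p q
    ... | tri< p<q _ _ = p<q
    ... | tri≈ _ refl _ = contradiction lt (⊰-irrefl (λ _ → refl))
    ... | tri> _ _ q<p = contradiction lt (⊰-asym (itinerary-mono q<p))

  private
    itinerary-period : ∀ x → Period (itinerary x) n
    itinerary-period x i = cong (lookup a) (iter-period τ n (iter-n cyc x) i)

  periodic-codeWord : ∀ x m → periodic (codeWord τ x a) m ≡ lookup a (iter τ m x)
  periodic-codeWord x m = trans (lookup∘tabulate _ (m mod n))
    (trans (cong (itinerary x) (toℕ-% m)) (sym (Period-% (itinerary-period x) m)))

  private
    shift-code : ∀ x i m → shiftBy i (periodic (codeWord τ x a)) m ≡ itinerary (iter τ i x) m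
    shift-code x i m = trans (periodic-codeWord x (i + m)) (sym (itinerary-iter i m x))

  code-pattern : ∀ x → IsPatternOf (allPlus k) (codeWord τ x a) (orbit τ x)
  code-pattern x i j = mk⇔
    (λ lt → ⊰⇒≺ (⊰-resp (λ m → sym (shift-code x (toℕ i) m)) (λ m → sym (shift-code x (toℕ j) m))
      (itinerary-mono (subst₂ Fin._<_ (lookup∘tabulate _ i) (lookup∘tabulate _ j) lt))))
    (λ lt → subst₂ Fin._<_ (sym (lookup∘tabulate _ i)) (sym (lookup∘tabulate _ j))
      (itinerary-reflect (⊰-resp (shift-code x (toℕ i)) (shift-code x (toℕ j)) (≺⇒⊰ lt))))

  -- A period shorter than `n` would give `x` and a later point of its orbit the same itinerary.
  -- These points differ, the return time being at least `n`, and `itinerary-mono` separates them.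
  code-primitive : ∀ x → Primitive (codeWord τ x a)
  code-primitive x (d , d<n , d∣n , u , eq) with Finₚ.<-cmp x (iter τ (suc d) x)
  ... | tri< lt _ _ = ⊰-irrefl same (itinerary-mono lt)
    where
    same : itinerary x ≗ itinerary (iter τ (suc d) x)
    same m = sym (trans (sym (shift-code x (suc d) m))
      (trans (power⇒period (codeWord τ x a) d∣n u eq m) (periodic-codeWord x m)))
  ... | tri≈ _ x≡ _ = ℕₚ.<⇒≱ d<n (returnTime≥n cyc ℕ.z<s (sym x≡))
  ... | tri> _ _ gt = ⊰-irrefl same (itinerary-mono gt)
    where
    same : itinerary (iter τ (suc d) x) ≗ itinerary x
    same m = trans (sym (shift-code x (suc d) m))
      (trans (power⇒period (codeWord τ x a) d∣n u eq m) (periodic-codeWord x m))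

-- The labelled cycle of a word and its pattern

module _ {k n : ℕ} .{{_ : NonZero n}} {w : Vec (Fin k) n} {π : Vec (Fin n) n}
         (perm : IsPerm π) (pattern′ : IsPatternOf (allPlus k) w π) where

  private
    -- The pattern read cyclically, so that the last position has the first as its successor.
    P : ℕ → Fin n
    P i = lookup π (i mod n)

    P-period : Period P n
    P-period = periodic-period π

    π⁻¹ : Fin n → Fin n
    π⁻¹ y = proj₁ (injective⇒surjective (lookup π) perm y)

    π-π⁻¹ : ∀ y → lookup π (π⁻¹ y) ≡ y
    π-π⁻¹ y = proj₂ (injective⇒surjective (lookup π) perm y)

    π⁻¹-π : ∀ i → π⁻¹ (lookup π i) ≡ i
    π⁻¹-π i = perm _ _ (π-π⁻¹ (lookup π i))

    P-π⁻¹ : ∀ y → P (toℕ (π⁻¹ y)) ≡ y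
    P-π⁻¹ y = trans (periodic-toℕ π (π⁻¹ y)) (π-π⁻¹ y)

    τ : Vec (Fin n) n
    τ = tabulate (λ y → P (suc (toℕ (π⁻¹ y))))

    a : Vec (Fin k) n
    a = tabulate (λ y → lookup w (π⁻¹ y))

    τ-P : ∀ i → lookup τ (P i) ≡ P (suc i)
    τ-P i = begin
      lookup τ (P i)              ≡⟨ lookup∘tabulate _ (P i) ⟩
      P (suc (toℕ (π⁻¹ (P i))))   ≡⟨ cong (P ∘ suc ∘ toℕ) (π⁻¹-π (i mod n)) ⟩
      P (1 + toℕ (i mod n))       ≡⟨ cong (P ∘ suc) (toℕ-% i) ⟩
      P (1 + i % n)               ≡⟨ Period-% (Period-shift P-period 1) i ⟨
      P (suc i)                   ∎
      where open ≡-Reasoning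

    iter-P : ∀ j i → iter τ j (P i) ≡ P (j + i)
    iter-P zero    i = refl
    iter-P (suc j) i = trans (cong (lookup τ) (iter-P j i)) (τ-P (j + i))

    τ-cyclic : IsCyclic τ
    τ-cyclic = τ-perm , reach
      where
      iter-n′ : ∀ y → iter τ n y ≡ y
      iter-n′ y = begin
        iter τ n y                      ≡⟨ cong (iter τ n) (P-π⁻¹ y) ⟨
        iter τ n (P (toℕ (π⁻¹ y)))      ≡⟨ iter-P n _ ⟩
        P (n + toℕ (π⁻¹ y))             ≡⟨ P-period _ ⟩
        P (toℕ (π⁻¹ y))                 ≡⟨ P-π⁻¹ y ⟩
        y                               ∎
        where open ≡-Reasoning
      n-1 = ℕ.pred n
      -- Since the n-th iterate is the identity, the one before it is a left inverse of `τ`, which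
      -- yields injectivity.
      back : ∀ y → iter τ n-1 (lookup τ y) ≡ y
      back y = begin
        iter τ n-1 (iter τ 1 y) ≡⟨ iter-+ τ n-1 1 y ⟨
        iter τ (n-1 + 1) y      ≡⟨ cong (λ z → iter τ z y) (trans (ℕₚ.+-comm n-1 1) (ℕₚ.suc-pred n)) ⟩
        iter τ n y              ≡⟨ iter-n′ y ⟩
        y                       ∎
        where open ≡-Reasoning
      τ-perm : IsPerm τ
      τ-perm y z eq = trans (sym (back y)) (trans (cong (iter τ n-1) eq) (back z))
      reach : ∀ y z → ∃ λ j → iter τ j y ≡ z
      reach y z = j , (begin
        iter τ j y            ≡⟨ cong (iter τ j) (P-π⁻¹ y) ⟨
        iter τ j (P i)        ≡⟨ iter-P j i ⟩
        P (j + i)             ≡⟨ cong P (trans (ℕₚ.+-assoc i′ (n ∸ i) i) (cong (_+_ i′) (ℕₚ.m∸n+n≡m (ℕₚ.<⇒≤ (toℕ<n (π⁻¹ y)))))) ⟩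
        P (i′ + n)            ≡⟨ cong P (ℕₚ.+-comm i′ n) ⟩
        P (n + i′)            ≡⟨ P-period i′ ⟩
        P i′                  ≡⟨ P-π⁻¹ z ⟩
        z                     ∎)
        where
        open ≡-Reasoning
        i  = toℕ (π⁻¹ y)
        i′ = toℕ (π⁻¹ z)
        -- From position `i` on to the end of the word and then to `i′`: this always goes once past
        -- the end, so no comparison of `i` with `i′` is needed.
        j  = i′ + (n ∸ i)

    shift-mod : ∀ i m → shiftBy i (periodic w) m ≡ shiftBy (toℕ (i mod n)) (periodic w) m
    shift-mod i m = begin
      periodic w (i + m)              ≡⟨ cong (periodic w) (ℕₚ.+-comm i m) ⟩
      periodic w (m + i)              ≡⟨ Period-% (Period-shift (periodic-period w) m) i ⟩
      periodic w (m + i % n)          ≡⟨ cong (λ z → periodic w (m + z)) (toℕ-% i) ⟨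
      periodic w (m + toℕ (i mod n))  ≡⟨ cong (periodic w) (ℕₚ.+-comm m _) ⟩
      periodic w (toℕ (i mod n) + m)  ∎
      where open ≡-Reasoning

    letter : ∀ y → periodic w (toℕ (π⁻¹ y) + 0) ≡ lookup a y
    letter y = trans (cong (periodic w) (ℕₚ.+-identityʳ _))
                 (trans (periodic-toℕ w (π⁻¹ y)) (sym (lookup∘tabulate _ y)))

    -- If the two shifted words differ in the first letter, the labels rise strictly. Otherwise
    -- deleting the common letter keeps their order, as all signs are plus, and the pattern reads
    -- the order of the tails as τ p < τ q.
    a-compatible : Compatible τ a
    a-compatible p q p<q with ≺⇒⊰ (to (pattern′ (π⁻¹ p) (π⁻¹ q))
                                 (subst₂ Fin._<_ (sym (π-π⁻¹ p)) (sym (π-π⁻¹ q)) p<q))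
    ... | zero , _ , lt = ℕₚ.<⇒≤ lt′ , λ eq → contradiction (cong toℕ eq) (ℕₚ.<⇒≢ lt′)
      where
      lt′ : lookup a p Fin.< lookup a q
      lt′ = subst₂ Fin._<_ (letter p) (letter q) lt
    ... | suc j , agree , lt = ℕₚ.≤-reflexive (cong toℕ eq) , λ _ → ℕₚ.<⇒≤ τp<τq
      where
      eq : lookup a p ≡ lookup a q
      eq = trans (sym (letter p)) (trans (agree 0 ℕ.z<s) (letter q))
      tail : shiftBy (suc (toℕ (π⁻¹ p))) (periodic w) ⊰ shiftBy (suc (toℕ (π⁻¹ q))) (periodic w)
      tail = j ,
        (λ i i<j → trans (cong (periodic w) (sym (ℕₚ.+-suc _ i)))
          (trans (agree (suc i) (s≤s i<j)) (cong (periodic w) (ℕₚ.+-suc _ i)))) ,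
        subst₂ Fin._<_ (cong (periodic w) (ℕₚ.+-suc _ j)) (cong (periodic w) (ℕₚ.+-suc _ j)) lt
      τp<τq : lookup τ p Fin.< lookup τ q
      τp<τq = subst₂ Fin._<_ (sym (lookup∘tabulate _ p)) (sym (lookup∘tabulate _ q))
        (from (pattern′ (suc (toℕ (π⁻¹ p)) mod n) (suc (toℕ (π⁻¹ q)) mod n))
          (⊰⇒≺ (⊰-resp (shift-mod (suc (toℕ (π⁻¹ p)))) (shift-mod (suc (toℕ (π⁻¹ q)))) tail)))

    iter-P₀ : ∀ i → iter τ (toℕ i) (P 0) ≡ lookup π i
    iter-P₀ i = trans (iter-P (toℕ i) 0) (trans (cong P (ℕₚ.+-identityʳ _)) (periodic-toℕ π i))

  pattern⇒code : ∃ λ τ → ∃ λ x → ∃ λ (a : Vec (Fin k) n) →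
                 IsCyclic τ × Compatible τ a × orbit τ x ≡ π × codeWord τ x a ≡ w
  pattern⇒code = τ , P 0 , a , τ-cyclic , a-compatible ,
    Vec-ext (λ i → trans (lookup∘tabulate _ i) (iter-P₀ i)) ,
    Vec-ext (λ i → begin
      lookup (codeWord τ (P 0) a) i         ≡⟨ lookup∘tabulate _ i ⟩
      lookup a (iter τ (toℕ i) (P 0))       ≡⟨ cong (lookup a) (iter-P₀ i) ⟩
      lookup a (lookup π i)                 ≡⟨ lookup∘tabulate _ (lookup π i) ⟩
      lookup w (π⁻¹ (lookup π i))           ≡⟨ cong (lookup w) (π⁻¹-π i) ⟩
      lookup w i                            ∎)
    where open ≡-Reasoning

-- Sizes of the sets of primitive words and of patterns

-- The shift by `i` cannot be undone directly; moving on by `f` = n - i completes it to a full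
-- period `n`. The index f + m may exceed `n` and is reduced before the hypothesis is used.
agree⇒period : {A : Set} {s : ℕ → A} {n : ℕ} .{{_ : NonZero n}} → Period s n → ∀ {i j} → i < j → j < n →
               (∀ m → m < n → s (i + m) ≡ s (j + m)) → Period s (j ∸ i)
agree⇒period {s = s} {n} p {i} {j} i<j j<n agree m = begin
  s (e + m)               ≡⟨ p (e + m) ⟨
  s (n + (e + m))         ≡⟨ cong s (cong (_+ (e + m)) (ℕₚ.m+[n∸m]≡n i≤n)) ⟨
  s ((i + f) + (e + m))   ≡⟨ cong s (solve 4 (λ i f e m → (i :+ f) :+ (e :+ m) := (i :+ e) :+ (f :+ m)) refl i f e m) ⟩
  s ((i + e) + (f + m))   ≡⟨ cong s (cong (_+ (f + m)) (ℕₚ.m+[n∸m]≡n (ℕₚ.<⇒≤ i<j))) ⟩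
  s (j + (f + m))         ≡⟨ Period-% (Period-shift p j) (f + m) ⟩
  s (j + (f + m) % n)     ≡⟨ agree _ (m%n<n (f + m) n) ⟨
  s (i + (f + m) % n)     ≡⟨ Period-% (Period-shift p i) (f + m) ⟨
  s (i + (f + m))         ≡⟨ cong s (ℕₚ.+-assoc i f m) ⟨
  s (i + f + m)           ≡⟨ cong (λ z → s (z + m)) (ℕₚ.m+[n∸m]≡n i≤n) ⟩
  s (n + m)               ≡⟨ p m ⟩
  s m                     ∎
  where
  open ≡-Reasoning
  open +-*-Solver
  i≤n = ℕₚ.<⇒≤ (ℕₚ.<-trans i<j j<n)
  e = j ∸ i
  f = n ∸ i

module _ {k n : ℕ} .{{_ : NonZero n}} {w : Vec (Fin k) n} (prim : Primitive w) where

  private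
    shift : Fin n → Word k
    shift i = shiftBy (toℕ i) (periodic w)

    -- Agreement would make j - i a positive period below `n`, although `n` divides every period of
    -- a primitive word.
    ¬agree< : ∀ i j → i Fin.< j → ¬ (∀ m → m < n → shift i m ≡ shift j m)
    ¬agree< i j i<j agree = ℕₚ.<⇒≱ (ℕₚ.≤-<-trans (ℕₚ.m∸n≤m (toℕ j) (toℕ i)) (toℕ<n j))
      (Div.∣⇒≤ {{ℕ.>-nonZero (ℕₚ.m<n⇒0<n∸m i<j)}}
        (primitive⇒n∣period w prim (toℕ j ∸ toℕ i)
          (agree⇒period {s = periodic w} (periodic-period w) i<j (toℕ<n j) agree)))

    ⊰-conn : ∀ i j → i ≢ j → shift i ⊰ shift j ⊎ shift j ⊰ shift i
    ⊰-conn i j i≢j with firstDiff {s = shift i} {shift j} n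
    ... | inj₂ (_ , _ , agree , ≢) = ≢⇒⊰ agree ≢
    ... | inj₁ agree with Finₚ.<-cmp i j
    ... | tri< i<j _ _ = contradiction agree (¬agree< i j i<j)
    ... | tri≈ _ i≡j _ = contradiction i≡j i≢j
    ... | tri> _ _ j<i = contradiction (λ m m<n → sym (agree m m<n)) (¬agree< j i j<i)

    _⊰?_ : ∀ i j → Dec (shift i ⊰ shift j)
    i ⊰? j with i Fin.≟ j
    ... | yes refl = no (⊰-irrefl (λ _ → refl))
    ... | no  i≢j with ⊰-conn i j i≢j
    ... | inj₁ lt = yes lt
    ... | inj₂ gt = no (⊰-asym gt)

  pattern-exists : ∃ λ π → IsPerm π × IsPatternOf (allPlus k) w π
  pattern-exists =
    let (π , perm , order) = ranking _⊰?_ (⊰-irrefl (λ _ → refl)) ⊰-trans ⊰-conn in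
    π , perm , λ i j → ⇔.trans (order i j) (mk⇔ ⊰⇒≺ ≺⇒⊰)

pattern-unique : ∀ {k n} .{{_ : NonZero n}} {σ : Fin k → Sign} (w : Vec (Fin k) n) {π ρ : Vec (Fin n) n} →
                 IsPerm π → IsPerm ρ → IsPatternOf σ w π → IsPatternOf σ w ρ → π ≡ ρ
pattern-unique w pπ pρ f g = sameOrder⇒≡ _ _ pπ pρ (λ i j → ⇔.trans (f i j) (⇔.sym (g i j)))

module _ {n : ℕ} .{{_ : NonZero n}} {τ τ′ : Vec (Fin n) n} {x x′ : Fin n}
         (cyc : IsCyclic τ) (cyc′ : IsCyclic τ′) (eq : orbit τ x ≡ orbit τ′ x′) where

  orbit-iter : ∀ m → iter τ m x ≡ iter τ′ m x′
  orbit-iter m = trans (sym (periodic-orbit cyc x m))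
    (trans (cong (λ π → periodic π m) eq) (periodic-orbit cyc′ x′ m))

  -- Every point occurs on the orbit, and the entry after it is its image.
  orbit-injective : τ ≡ τ′
  orbit-injective = Vec-ext λ y → let (j , τʲx≡y) = proj₂ cyc x y in begin
    lookup τ y                  ≡⟨ cong (lookup τ) τʲx≡y ⟨
    iter τ (suc j) x            ≡⟨ orbit-iter (suc j) ⟩
    iter τ′ (suc j) x′          ≡⟨ cong (lookup τ′) (trans (sym (orbit-iter j)) τʲx≡y) ⟩
    lookup τ′ y                 ∎
    where open ≡-Reasoning

-- The word has only one pattern, the pattern is the orbit and so fixes cycle and root, and along
-- the orbit the letters spell out the labelling.
codeWord-injective : ∀ {k n} .{{_ : NonZero n}} {τ τ′ : Vec (Fin n) n} {x x′ : Fin n} {a a′ : Vec (Fin k) n} →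
  IsCyclic τ → IsCyclic τ′ → Compatible τ a → Compatible τ′ a′ →
  codeWord τ x a ≡ codeWord τ′ x′ a′ → τ ≡ τ′ × x ≡ x′ × a ≡ a′
codeWord-injective {k} {n} {τ} {τ′} {x} {x′} {a} {a′} cyc cyc′ com com′ eq =
  orbit-injective cyc cyc′ orb , orbit-iter cyc cyc′ orb 0 ,
  Vec-ext λ y → let (j , τʲx≡y) = proj₂ cyc x y in begin
    lookup a y                          ≡⟨ cong (lookup a) τʲx≡y ⟨
    lookup a (iter τ j x)               ≡⟨ periodic-codeWord a cyc com x j ⟨
    periodic (codeWord τ x a) j         ≡⟨ cong (λ w → periodic w j) eq ⟩
    periodic (codeWord τ′ x′ a′) j      ≡⟨ periodic-codeWord a′ cyc′ com′ x′ j ⟩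
    lookup a′ (iter τ′ j x′)            ≡⟨ cong (lookup a′) (trans (sym (orbit-iter cyc cyc′ orb j)) τʲx≡y) ⟩
    lookup a′ y                         ∎
  where
  open ≡-Reasoning
  orb : orbit τ x ≡ orbit τ′ x′
  orb = pattern-unique (codeWord τ x a) (orbit-perm cyc x) (orbit-perm cyc′ x′) (code-pattern a cyc com x)
    (subst (λ w → IsPatternOf (allPlus k) w (orbit τ′ x′)) (sym eq) (code-pattern a′ cyc′ com′ x′))

-- Labellings of a cycle counted by its descents

nCk>0 : ∀ n k → k ≤ n → 0 < n C k
nCk>0 n       zero    _         = subst (0 <_) (sym (trans (nCk≡nC[n∸k] {0} {n} z≤n) (nCn≡1 n))) ℕ.z<s
nCk>0 (suc n) (suc k) (s≤s k≤n) =
  subst (0 <_) (nCk+nC[k+1]≡[n+1]C[k+1] n k) (ℕₚ.<-≤-trans (nCk>0 n k k≤n) (ℕₚ.m≤m+n _ _))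

-- Lowering each label by the number of descents before it leaves a weakly increasing sequence of
-- length n over k - (i - 1) letters, whence binom(n+k-i, n). The symmetry of binomials gives the
-- stated form.
cycDesc-size : ∀ {n i k} .{{_ : NonZero n}} {τ : Vec (Fin n) n} → CycDesc n i τ → i ≤ k →
               HasSize (Labels {k = k} 0 τ) (((n + k) ∸ i) C (k ∸ i))
cycDesc-size {suc m} {k = k} {τ} (_ , refl) i≤k =
  subst (HasSize _) (begin
    (m + k ∸ d) C suc m                       ≡⟨ cong (_C suc m) rw ⟩
    (suc m + (k ∸ (d + 1))) C suc m           ≡⟨ nCk≡nC[n∸k] (ℕₚ.m≤m+n (suc m) _) ⟩
    (suc m + (k ∸ (d + 1))) C (suc m + (k ∸ (d + 1)) ∸ suc m)
                                              ≡⟨ cong₂ _C_ (sym (ℕₚ.+-∸-assoc (suc m) i≤k)) (ℕₚ.m+n∸m≡n (suc m) _) ⟩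
    (suc m + k ∸ (d + 1)) C (k ∸ (d + 1))     ∎)
  (Labels-size m 0 k refl τ)
  where
  open ≡-Reasoning
  d = descents τ
  rw : m + k ∸ d ≡ suc m + (k ∸ (d + 1))
  rw = trans (cong (suc m + k ∸_) (ℕₚ.+-comm 1 d)) (ℕₚ.+-∸-assoc (suc m) i≤k)

-- Each of the i - 1 descents forces a new letter. Formally, for i > k the binomial of `Labels-size`
-- has its upper number below its lower one, so there is no labelling.
Labels⇒i≤k : ∀ {n i k} .{{_ : NonZero n}} {τ : Vec (Fin n) n} {a : Vec (Fin k) n} →
             CycDesc n i τ → Labels 0 τ a → i ≤ k
Labels⇒i≤k {suc m} {k = k} {τ} {a} (_ , refl) ok with descents τ + 1 ℕ.≤? k
... | yes i≤k = i≤k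
... | no  i≰k = ⊥-elim (HasSize-0
  (subst (HasSize _) (k>n⇒nCk≡0 (s≤s (ℕₚ.m≤n+o⇒m∸n≤o (m + k) (descents τ)
      (ℕₚ.≤-trans (ℕₚ.+-monoʳ-≤ m k≤d) (ℕₚ.≤-reflexive (ℕₚ.+-comm m _))))))
    (Labels-size m 0 k refl τ)) {a} ok)
  where
  k≤d : k ≤ descents τ
  k≤d = ℕ.s≤s⁻¹ (subst (suc k ≤_) (ℕₚ.+-comm (descents τ) 1) (ℕₚ.≰⇒> i≰k))

module _ {n i : ℕ} {τ : Vec (Fin n) n} (cd : CycDesc n i τ) where

  cycDesc⇒label : ∀ {k} .{{_ : NonZero n}} → i ≤ k → ∃ λ (a : Vec (Fin k) n) → Compatible τ a
  cycDesc⇒label {k} i≤k =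
    let (a , ok) = HasSize-∃ (cycDesc-size cd i≤k) (nCk>0 _ _ (ℕₚ.∸-monoˡ-≤ i (ℕₚ.m≤n+m k n))) in
    a , Labels⇒Compatible 0 τ a ok

  -- With one letter only, the word coded by τ would be a power.
  2≤i : .{{_ : NonZero n}} → 2 ≤ n → 2 ≤ i
  2≤i 2≤n with i ℕ.≤? 1
  ... | no i≰1 = ℕₚ.≰⇒> i≰1
  ... | yes i≤1 = ⊥-elim (code-primitive (proj₁ lab) (proj₁ cd) (proj₂ lab) (0 mod n)
      (0 , 2≤n , Div.1∣ n , zero ∷ [] , λ j → all₀ _ _))
    where
    lab = cycDesc⇒label {1} i≤1
    all₀ : (x y : Fin 1) → x ≡ y
    all₀ zero zero = refl

-- The range 2, ..., k of i. The sum in `binomSum k` runs over `indices (k ∸ 1)`.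
indices : ℕ → List ℕ
indices k = List.map (_+_ 2) (upTo (k ∸ 1))

indices-unique : ∀ k → Unique (indices k)
indices-unique k = Uniqueₚ.map⁺ (λ { refl → refl }) (Uniqueₚ.upTo⁺ (k ∸ 1))

∈-indices⁻ : ∀ {k i} → i ∈ indices k → i ≤ k
∈-indices⁻ {suc k} i∈ with ∈-map⁻ (_+_ 2) i∈
... | j , j∈ , refl = s≤s (∈-upTo⁻ j∈)

∈-indices⁺ : ∀ {k i} → 2 ≤ i → i ≤ k → i ∈ indices k
∈-indices⁺ {suc k} (s≤s (s≤s _)) (s≤s i≤k) = ∈-map⁺ (_+_ 2) (∈-upTo⁺ i≤k)

module _ (k n : ℕ) .{{_ : NonZero n}} (2≤n : 2 ≤ n) (c : ℕ → ℕ) (sizes : ∀ i → HasSize (CycDesc n i) (c i)) where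

  private
    -- The component `i` is determined by `τ`; it is carried along so that `HasSize-Σ` produces the
    -- sum over i.
    Code : ℕ × Vec (Fin n) n × Fin n × Vec (Fin k) n → Set
    Code (i , τ , x , a) = i ∈ indices k × CycDesc n i τ × ⊤ × Labels 0 τ a

    word : ℕ × Vec (Fin n) n × Fin n × Vec (Fin k) n → Vec (Fin k) n
    word (i , τ , x , a) = codeWord τ x a

    word-primitive : ∀ {q} → Code q → Primitive (word q)
    word-primitive {_ , τ , x , a} (_ , (cyc , _) , _ , ok) =
      code-primitive a cyc (Labels⇒Compatible 0 τ a ok) x

    word-injective : ∀ {q q′} → Code q → Code q′ → word q ≡ word q′ → q ≡ q′
    word-injective {i , τ , x , a} {i′ , τ′ , x′ , a′} (_ , (cyc , d) , _ , ok) (_ , (cyc′ , d′) , _ , ok′) eq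
      = let (τ≡τ′ , x≡x′ , a≡a′) = codeWord-injective {τ = τ} {τ′} {x} {x′} {a} {a′} cyc cyc′
              (Labels⇒Compatible 0 τ a ok) (Labels⇒Compatible 0 τ′ a′ ok′) eq
        in cong₂ _,_ (trans (sym d) (trans (cong (λ τ → descents τ + 1) τ≡τ′) d′))
             (cong₂ _,_ τ≡τ′ (cong₂ _,_ x≡x′ a≡a′))

    word-surjective : ∀ {w} → Primitive w → ∃ λ q → Code q × word q ≡ w
    word-surjective {w} prim with pattern-exists {w = w} prim
    ... | π , perm , pat with pattern⇒code {w = w} {π} perm pat
    ... | τ , x , a , cyc , com , _ , eq =
      (descents τ + 1 , τ , x , a) ,
      (∈-indices⁺ (2≤i (cyc , refl) 2≤n) (Labels⇒i≤k {a = a} (cyc , refl) ok) , (cyc , refl) , tt , ok) , eq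
      where ok = Compatible⇒Labels 0 τ a (λ _ → z≤n) com

    Rooted : ℕ × Vec (Fin n) n × Fin n → Set
    Rooted (i , τ , x) = i ∈ indices k × CycDesc n i τ × ⊤

    orbitOf : ℕ × Vec (Fin n) n × Fin n → Vec (Fin n) n
    orbitOf (i , τ , x) = orbit τ x

    orbit-pattern : ∀ {q} → Rooted q → InPatterns (allPlus k) n (orbitOf q)
    orbit-pattern {_ , τ , x} (i∈ , cd@(cyc , _) , _) =
      let (a , com) = cycDesc⇒label cd (∈-indices⁻ i∈) in
      orbit-perm cyc x , codeWord τ x a , code-primitive a cyc com x , code-pattern a cyc com x

    orbitOf-injective : ∀ {q q′} → Rooted q → Rooted q′ → orbitOf q ≡ orbitOf q′ → q ≡ q′
    orbitOf-injective {i , τ , x} {i′ , τ′ , x′} (_ , (cyc , d) , _) (_ , (cyc′ , d′) , _) eq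
      = let τ≡τ′ = orbit-injective {τ = τ} {τ′} {x} {x′} cyc cyc′ eq in
        cong₂ _,_ (trans (sym d) (trans (cong (λ τ → descents τ + 1) τ≡τ′) d′))
          (cong₂ _,_ τ≡τ′ (orbit-iter {τ = τ} {τ′} {x} {x′} cyc cyc′ eq 0))

    orbitOf-surjective : ∀ {π} → InPatterns (allPlus k) n π → ∃ λ q → Rooted q × orbitOf q ≡ π
    orbitOf-surjective {π} (perm , w , _ , pat) with pattern⇒code {w = w} {π} perm pat
    ... | τ , x , a , cyc , com , eq , _ =
      (descents τ + 1 , τ , x) ,
      (∈-indices⁺ (2≤i (cyc , refl) 2≤n)
        (Labels⇒i≤k {a = a} (cyc , refl) (Compatible⇒Labels 0 τ a (λ _ → z≤n) com)) , (cyc , refl) , tt) , eq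

  primitive-size : HasSize {Vec (Fin k) n} Primitive
    (sum (List.map (λ i → c i * (n * (((n + k) ∸ i) C (k ∸ i)))) (indices k)))
  primitive-size = HasSize-bij word word-primitive word-injective word-surjective
    (HasSize-Σ (λ i → c i * (n * (((n + k) ∸ i) C (k ∸ i)))) (indices-unique k) λ {i} i∈ →
      HasSize-×-const (sizes i) λ cd →
        HasSize-×-const (HasSize-Fin n) λ _ → cycDesc-size cd (∈-indices⁻ i∈))

  patterns-size : HasSize (InPatterns (allPlus k) n) (sum (List.map (λ i → c i * n) (indices k)))
  patterns-size = HasSize-bij orbitOf orbit-pattern orbitOf-injective orbitOf-surjective
    (HasSize-Σ (λ i → c i * n) (indices-unique k) λ {i} i∈ →
      HasSize-×-const (sizes i) λ _ → HasSize-Fin n)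

-- The Möbius function

Σℤ : {A : Set} → List A → (A → ℤ) → ℤ
Σℤ xs f = sumℤ (List.map f xs)

indicator : {P : Set} → Dec P → ℤ
indicator d = if does d then + 1 else + 0

if-yes : {P A : Set} (d : Dec P) {x y : A} → P → (if does d then x else y) ≡ x
if-yes d {x} {y} p = cong (if_then x else y) (dec-true d p)

if-no : {P A : Set} (d : Dec P) {x y : A} → ¬ P → (if does d then x else y) ≡ y
if-no d {x} {y} ¬p = cong (if_then x else y) (dec-false d ¬p)

Σℤ-cong : {A : Set} {f g : A → ℤ} (xs : List A) → (∀ {x} → x ∈ xs → f x ≡ g x) → Σℤ xs f ≡ Σℤ xs g
Σℤ-cong []       eq = refl
Σℤ-cong (x ∷ xs) eq = cong₂ ℤ._+_ (eq (here refl)) (Σℤ-cong xs (eq ∘ there))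

Σℤ-zero : {A : Set} (xs : List A) → Σℤ xs (λ _ → + 0) ≡ + 0
Σℤ-zero []       = refl
Σℤ-zero (x ∷ xs) = trans (ℤₚ.+-identityˡ _) (Σℤ-zero xs)

+-interchangeℤ : ∀ a b c d → (a ℤ.+ b) ℤ.+ (c ℤ.+ d) ≡ (a ℤ.+ c) ℤ.+ (b ℤ.+ d)
+-interchangeℤ a b c d = begin
  (a ℤ.+ b) ℤ.+ (c ℤ.+ d)   ≡⟨ ℤₚ.+-assoc a b (c ℤ.+ d) ⟩
  a ℤ.+ (b ℤ.+ (c ℤ.+ d))   ≡⟨ cong (ℤ._+_ a) (ℤₚ.+-assoc b c d) ⟨
  a ℤ.+ ((b ℤ.+ c) ℤ.+ d)   ≡⟨ cong (λ z → a ℤ.+ (z ℤ.+ d)) (ℤₚ.+-comm b c) ⟩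
  a ℤ.+ ((c ℤ.+ b) ℤ.+ d)   ≡⟨ cong (ℤ._+_ a) (ℤₚ.+-assoc c b d) ⟩
  a ℤ.+ (c ℤ.+ (b ℤ.+ d))   ≡⟨ ℤₚ.+-assoc a c (b ℤ.+ d) ⟨
  (a ℤ.+ c) ℤ.+ (b ℤ.+ d)   ∎
  where open ≡-Reasoning

Σℤ-+ : {A : Set} (xs : List A) (f g : A → ℤ) → Σℤ xs (λ x → f x ℤ.+ g x) ≡ Σℤ xs f ℤ.+ Σℤ xs g
Σℤ-+ []       f g = refl
Σℤ-+ (x ∷ xs) f g = trans (cong (ℤ._+_ (f x ℤ.+ g x)) (Σℤ-+ xs f g)) (+-interchangeℤ (f x) (g x) _ _)

Σℤ-*ˡ : {A : Set} (c : ℤ) (xs : List A) (f : A → ℤ) → Σℤ xs (λ x → c ℤ.* f x) ≡ c ℤ.* Σℤ xs f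
Σℤ-*ˡ c []       f = sym (ℤₚ.*-zeroʳ c)
Σℤ-*ˡ c (x ∷ xs) f = trans (cong (ℤ._+_ (c ℤ.* f x)) (Σℤ-*ˡ c xs f)) (sym (ℤₚ.*-distribˡ-+ c (f x) _))

Σℤ-neg : {A : Set} (xs : List A) (f : A → ℤ) → Σℤ xs (λ x → ℤ.- f x) ≡ ℤ.- Σℤ xs f
Σℤ-neg []       f = refl
Σℤ-neg (x ∷ xs) f = trans (cong (ℤ._+_ (ℤ.- f x)) (Σℤ-neg xs f)) (sym (ℤₚ.neg-distrib-+ (f x) _))

Σℤ-swap : {A B : Set} (xs : List A) (ys : List B) (f : A → B → ℤ) →
          Σℤ xs (λ x → Σℤ ys (f x)) ≡ Σℤ ys (λ y → Σℤ xs (λ x → f x y))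
Σℤ-swap []       ys f = sym (Σℤ-zero ys)
Σℤ-swap (x ∷ xs) ys f = trans (cong (ℤ._+_ (Σℤ ys (f x))) (Σℤ-swap xs ys f)) (sym (Σℤ-+ ys (f x) _))

Σℤ-↭ : {A : Set} {xs ys : List A} (f : A → ℤ) → xs ↭ ys → Σℤ xs f ≡ Σℤ ys f
Σℤ-↭ f p = foldr-commMonoid (setoid ℤ) ℤₚ.+-0-isCommutativeMonoid (↭⇒↭ₛ (map⁺ f p))

module _ {A : Set} {P : A → Set} (P? : Decidable P) where

  Σℤ-filter : ∀ xs f → Σℤ xs (λ x → if does (P? x) then f x else + 0) ≡ Σℤ (filter P? xs) f
  Σℤ-filter []       f = refl
  Σℤ-filter (x ∷ xs) f with does (P? x)
  ... | true  = cong (ℤ._+_ (f x)) (Σℤ-filter xs f)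
  ... | false = trans (ℤₚ.+-identityˡ _) (Σℤ-filter xs f)

  Σℤ-split : ∀ xs f → Σℤ xs f ≡ Σℤ (filter P? xs) f ℤ.+ Σℤ (filter (¬? ∘ P?) xs) f
  Σℤ-split []       f = refl
  Σℤ-split (x ∷ xs) f with does (P? x)
  ... | true  = trans (cong (ℤ._+_ (f x)) (Σℤ-split xs f)) (sym (ℤₚ.+-assoc (f x) _ _))
  ... | false = begin
    f x ℤ.+ Σℤ xs f        ≡⟨ cong (ℤ._+_ (f x)) (Σℤ-split xs f) ⟩
    f x ℤ.+ (S ℤ.+ T)      ≡⟨ ℤₚ.+-assoc (f x) S T ⟨
    f x ℤ.+ S ℤ.+ T        ≡⟨ cong (ℤ._+ T) (ℤₚ.+-comm (f x) S) ⟩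
    S ℤ.+ f x ℤ.+ T        ≡⟨ ℤₚ.+-assoc S (f x) T ⟩
    S ℤ.+ (f x ℤ.+ T)      ∎
    where
    open ≡-Reasoning
    S = Σℤ (filter P? xs) f
    T = Σℤ (filter (¬? ∘ P?) xs) f

  Σℤ-indicator : ∀ xs → Σℤ xs (λ x → indicator (P? x)) ≡ + length (filter P? xs)
  Σℤ-indicator []       = refl
  Σℤ-indicator (x ∷ xs) with does (P? x)
  ... | true  = cong (ℤ._+_ (+ 1)) (Σℤ-indicator xs)
  ... | false = trans (ℤₚ.+-identityˡ _) (Σℤ-indicator xs)

  HasSize-filter : ∀ {xs} → Unique xs → (∀ x → x ∈ xs) → HasSize P (length (filter P? xs))
  HasSize-filter {xs} u all = filter P? xs , Uniqueₚ.filter⁺ P? u ,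
    (λ x → mk⇔ (proj₂ ∘ ∈-filter⁻ P? {xs = xs}) (∈-filter⁺ P? (all x))) , refl

bool-≡ : ∀ {a b : Bool} → (a ≡ true → b ≡ true) → (b ≡ true → a ≡ true) → a ≡ b
bool-≡ {true}  {true}  f g = refl
bool-≡ {true}  {false} f g = sym (f refl)
bool-≡ {false} {true}  f g = g refl
bool-≡ {false} {false} f g = refl

and-map⁻ : {A : Set} {f : A → Bool} (xs : List A) → and (List.map f xs) ≡ true → ∀ {x} → x ∈ xs → f x ≡ true
and-map⁻ {f = f} (x ∷ xs) eq x∈ with f x in fx
and-map⁻ (x ∷ xs) eq (here refl) | true = fx
and-map⁻ (x ∷ xs) eq (there x∈)  | true = and-map⁻ xs eq x∈

and-map⁺ : {A : Set} {f : A → Bool} (xs : List A) → (∀ {x} → x ∈ xs → f x ≡ true) → and (List.map f xs) ≡ true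
and-map⁺ []       eq = refl
and-map⁺ (x ∷ xs) eq rewrite eq (here refl) = and-map⁺ xs (eq ∘ there)

∈-primeDivisors⁻ : ∀ d {p} → p ∈ primeDivisors d → Prime p × p ∣ d
∈-primeDivisors⁻ d = proj₂ ∘ ∈-filter⁻ (λ p → prime? p ×-dec (p ∣? d)) {xs = upTo (suc d)}

∈-primeDivisors⁺ : ∀ {d p} .{{_ : NonZero d}} → Prime p → p ∣ d → p ∈ primeDivisors d
∈-primeDivisors⁺ {d} pp p∣d = ∈-filter⁺ (λ p → prime? p ×-dec (p ∣? d)) (∈-upTo⁺ (s≤s (Div.∣⇒≤ p∣d))) (pp , p∣d)

primeDivisors-unique : ∀ d → Unique (primeDivisors d)
primeDivisors-unique d = Uniqueₚ.filter⁺ (λ p → prime? p ×-dec (p ∣? d)) (Uniqueₚ.upTo⁺ (suc d))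

Squarefree : ℕ → Set
Squarefree d = ∀ p → Prime p → ¬ p * p ∣ d

squarefreeᵇ⁻ : ∀ {d} .{{_ : NonZero d}} → squarefreeᵇ d ≡ true → Squarefree d
squarefreeᵇ⁻ {d} eq p pp pp∣d = contradiction
  (trans (sym (and-map⁻ (primeDivisors d) eq (∈-primeDivisors⁺ pp (Div.∣-trans (Div.m∣m*n p) pp∣d))))
         (cong not (dec-true ((p * p) ∣? d) pp∣d)))
  λ ()

squarefreeᵇ⁺ : ∀ {d} → Squarefree d → squarefreeᵇ d ≡ true
squarefreeᵇ⁺ {d} sf = and-map⁺ (primeDivisors d)
  λ {p} p∈ → cong not (dec-false ((p * p) ∣? d) (sf p (proj₁ (∈-primeDivisors⁻ d p∈))))

μ-square : ∀ {p d} .{{_ : NonZero d}} → Prime p → p * p ∣ d → μ d ≡ + 0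
μ-square {p} {d} pp pp∣d with squarefreeᵇ d in eq
... | false = refl
... | true  = contradiction pp∣d (squarefreeᵇ⁻ eq p pp)

prime∣prime : ∀ {p q} → Prime p → Prime q → p ∣ q → p ≡ q
prime∣prime pp pq p∣q with prime⇒irreducible pq p∣q
... | inj₂ p≡q = p≡q
... | inj₁ refl with () ← prime⇒nonTrivial pp

module _ {p e : ℕ} .{{_ : NonZero e}} (pp : Prime p) (p∤e : ¬ p ∣ e) where

  private
    instance
      p≢0 : NonZero p
      p≢0 = prime⇒nonZero pp
      pe≢0 : NonZero (p * e)
      pe≢0 = ℕₚ.m*n≢0 p e

    squarefree-* : squarefreeᵇ (p * e) ≡ squarefreeᵇ e
    squarefree-* = bool-≡
      (λ eq → squarefreeᵇ⁺ (λ q pq qq∣e → squarefreeᵇ⁻ eq q pq (Div.∣n⇒∣m*n p qq∣e)))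
      (λ eq → squarefreeᵇ⁺ (λ q pq → noSquare (squarefreeᵇ⁻ eq) q pq))
      where
      -- If p² divided p e, then p would divide e. For another prime q, Euclid's lemma removes p
      -- twice, once for each factor q, and leaves q² dividing e.
      noSquare : Squarefree e → Squarefree (p * e)
      noSquare sf q pq qq∣pe with q ℕ.≟ p
      ... | yes refl = p∤e (Div.*-cancelˡ-∣ p qq∣pe)
      ... | no q≢p with euclidsLemma p e pq (Div.∣-trans (Div.m∣m*n q) qq∣pe)
      ... | inj₁ q∣p = q≢p (prime∣prime pq pp q∣p)
      ... | inj₂ (divides f refl) with euclidsLemma p f pq
              (Div.*-cancelʳ-∣ q {{prime⇒nonZero pq}} (subst (q * q ∣_) (sym (ℕₚ.*-assoc p f q)) qq∣pe))
      ... | inj₁ q∣p = q≢p (prime∣prime pq pp q∣p)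
      ... | inj₂ q∣f = sf q pq (Div.*-monoˡ-∣ q q∣f)

    primeDivisors-* : primeDivisors (p * e) ↭ p ∷ primeDivisors e
    primeDivisors-* = unique∧set⇒↭ (primeDivisors-unique (p * e))
      (All.tabulate (λ { q∈ refl → p∤e (proj₂ (∈-primeDivisors⁻ e q∈)) }) ∷ primeDivisors-unique e)
      (λ q q∈ → case (∈-primeDivisors⁻ (p * e) q∈))
      (λ { q (here refl) → ∈-primeDivisors⁺ pp (Div.m∣m*n e)
         ; q (there q∈) → let (pq , q∣e) = ∈-primeDivisors⁻ e q∈ in ∈-primeDivisors⁺ pq (Div.∣n⇒∣m*n p q∣e) })
      where
      case : ∀ {q} → Prime q × q ∣ p * e → q ∈ p ∷ primeDivisors e
      case (pq , q∣pe) with euclidsLemma p e pq q∣pe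
      ... | inj₁ q∣p = here (prime∣prime pq pp q∣p)
      ... | inj₂ q∣e = there (∈-primeDivisors⁺ pq q∣e)

  -- Multiplying by a new prime leaves squarefreeness unchanged and adds one prime divisor, hence
  -- one sign.
  μ-prime-* : μ (p * e) ≡ ℤ.- μ e
  μ-prime-* rewrite squarefree-* | ↭-length primeDivisors-* with squarefreeᵇ e
  ... | true  = ℤₚ.-1*i≡-i _
  ... | false = refl

primeDivisor : ∀ q .{{_ : NonZero q}} → q ≢ 1 → ∃ λ p → Prime p × p ∣ q
primeDivisor q q≢1 with factorise q
... | record { factors = [] ; isFactorisation = eq } = contradiction eq q≢1
... | record { factors = p ∷ ps ; isFactorisation = eq ; factorsPrime = pp ∷ _ } =
  p , pp , subst (p ∣_) (sym eq) (Div.m∣m*n (product ps))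

-- The bound is separate from `q` because the Möbius sum always runs up to n, while `q` will be a
-- divisor of n depending on the word.
divisorsUpTo : ℕ → ℕ → List ℕ
divisorsUpTo N q = filter (_∣? q) (List.map suc (upTo N))

module _ {N q : ℕ} .{{q≢0 : NonZero q}} (q≤N : q ≤ N) where

  ∈-divisors⁻ : ∀ {d} → d ∈ divisorsUpTo N q → NonZero d × d ∣ q
  ∈-divisors⁻ d∈ with ∈-filter⁻ (_∣? q) {xs = List.map suc (upTo N)} d∈
  ... | d∈′ , d∣q with ∈-map⁻ suc d∈′
  ... | _ , _ , refl = _ , d∣q

  ∈-divisors⁺ : ∀ {d} → d ∣ q → d ∈ divisorsUpTo N q
  ∈-divisors⁺ {zero} 0∣q = contradiction (Div.0∣⇒≡0 0∣q) (ℕ.≢-nonZero⁻¹ q)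
  ∈-divisors⁺ {suc d} d∣q = ∈-filter⁺ (_∣? q)
    (∈-map⁺ suc (∈-upTo⁺ (ℕₚ.≤-trans (Div.∣⇒≤ d∣q) q≤N))) d∣q

  divisors-unique : Unique (divisorsUpTo N q)
  divisors-unique = Uniqueₚ.filter⁺ (_∣? q) (Uniqueₚ.map⁺ ℕₚ.suc-injective (Uniqueₚ.upTo⁺ N))

  -- For a prime p ∣ q the divisors d of q with p ∤ d cancel against the divisors p d.
  Σμ-divisors : Σℤ (divisorsUpTo N q) μ ≡ indicator (q ℕ.≟ 1)
  Σμ-divisors with q ℕ.≟ 1
  ... | yes refl = Σℤ-↭ μ (unique∧set⇒↭ divisors-unique ([] ∷ [])
          (λ d d∈ → here (Div.∣1⇒≡1 (proj₂ (∈-divisors⁻ d∈))))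
          (λ { d (here refl) → ∈-divisors⁺ Div.∣-refl }))
  ... | no q≢1 = let (p , pp , p∣q) = primeDivisor q q≢1 in
    trans (cancel p pp p∣q) (sym (if-no (q ℕ.≟ 1) q≢1))
    where
    D = divisorsUpTo N q
    cancel : ∀ p → Prime p → p ∣ q → Σℤ D μ ≡ + 0
    cancel p pp p∣q = begin
      Σℤ D μ                                      ≡⟨ Σℤ-split (p ∣?_) D μ ⟩
      Σℤ D₁ μ ℤ.+ Σℤ D₀ μ                         ≡⟨ cong (ℤ._+ Σℤ D₀ μ) (Σℤ-split ((p * p) ∣?_) D₁ μ) ⟩
      Σℤ D₂ μ ℤ.+ Σℤ D₁′ μ ℤ.+ Σℤ D₀ μ            ≡⟨ cong (λ z → z ℤ.+ Σℤ D₁′ μ ℤ.+ Σℤ D₀ μ) zeros ⟩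
      + 0 ℤ.+ Σℤ D₁′ μ ℤ.+ Σℤ D₀ μ                ≡⟨ cong (ℤ._+ Σℤ D₀ μ) (ℤₚ.+-identityˡ (Σℤ D₁′ μ)) ⟩
      Σℤ D₁′ μ ℤ.+ Σℤ D₀ μ                        ≡⟨ cong (ℤ._+ Σℤ D₀ μ) opposite ⟩
      ℤ.- Σℤ D₀ μ ℤ.+ Σℤ D₀ μ                     ≡⟨ ℤₚ.+-inverseˡ (Σℤ D₀ μ) ⟩
      + 0                                         ∎
      where
      open ≡-Reasoning
      instance
        p≢0 : NonZero p
        p≢0 = prime⇒nonZero pp
      -- The multiples of p² in `D₂` have μ = 0. What remains of the multiples of p, namely `D₁′`,
      -- is the image of `D₀` under multiplication by p.
      D₁  = filter (p ∣?_) D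
      D₀  = filter (¬? ∘ (p ∣?_)) D
      D₂  = filter ((p * p) ∣?_) D₁
      D₁′ = filter (¬? ∘ ((p * p) ∣?_)) D₁
      zeros : Σℤ D₂ μ ≡ + 0
      zeros = trans (Σℤ-cong D₂ (λ d∈ →
        let (d∈D₁ , pp∣d) = ∈-filter⁻ ((p * p) ∣?_) {xs = D₁} d∈
            (d≢0 , _)     = ∈-divisors⁻ (proj₁ (∈-filter⁻ (p ∣?_) {xs = D} d∈D₁))
        in μ-square {{d≢0}} pp pp∣d)) (Σℤ-zero D₂)
      D₁′⇒ : ∀ d → d ∈ D₁′ → d ∈ List.map (p *_) D₀
      D₁′⇒ d d∈ with ∈-filter⁻ (¬? ∘ ((p * p) ∣?_)) {xs = D₁} d∈
      ... | d∈D₁ , pp∤d with ∈-filter⁻ (p ∣?_) {xs = D} d∈D₁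
      ... | d∈D , divides e refl = subst (_∈ List.map (p *_) D₀) (ℕₚ.*-comm p e)
        (∈-map⁺ (p *_) (∈-filter⁺ (¬? ∘ (p ∣?_))
          (∈-divisors⁺ (Div.∣-trans (Div.m∣m*n p) (proj₂ (∈-divisors⁻ d∈D))))
          (λ p∣e → pp∤d (Div.*-monoˡ-∣ p p∣e))))
      ⇒D₁′ : ∀ d → d ∈ List.map (p *_) D₀ → d ∈ D₁′
      ⇒D₁′ d d∈ with ∈-map⁻ (p *_) d∈
      ... | e , e∈D₀ , refl with ∈-filter⁻ (¬? ∘ (p ∣?_)) {xs = D} e∈D₀
      ... | e∈D , p∤e = ∈-filter⁺ (¬? ∘ ((p * p) ∣?_))
        (∈-filter⁺ (p ∣?_) (∈-divisors⁺ pe∣q) (Div.m∣m*n e))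
        (λ pp∣pe → p∤e (Div.*-cancelˡ-∣ p pp∣pe))
        where
        pe∣q : p * e ∣ q
        pe∣q with proj₂ (∈-divisors⁻ e∈D)
        -- Since p divides q = f e but not e, it divides the cofactor f.
        ... | divides f q≡fe with euclidsLemma f e pp (subst (p ∣_) q≡fe p∣q)
        ... | inj₁ p∣f = subst (p * e ∣_) (sym q≡fe) (Div.*-monoˡ-∣ e p∣f)
        ... | inj₂ p∣e = contradiction p∣e p∤e
      opposite : Σℤ D₁′ μ ≡ ℤ.- Σℤ D₀ μ
      opposite = begin
        Σℤ D₁′ μ                    ≡⟨ Σℤ-↭ μ (unique∧set⇒↭
                                         (Uniqueₚ.filter⁺ (¬? ∘ ((p * p) ∣?_)) (Uniqueₚ.filter⁺ (p ∣?_) divisors-unique))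
                                         (Uniqueₚ.map⁺ (λ {x} {y} → ℕₚ.*-cancelˡ-≡ x y p)
                                           (Uniqueₚ.filter⁺ (¬? ∘ (p ∣?_)) divisors-unique))
                                         D₁′⇒ ⇒D₁′) ⟩
        Σℤ (List.map (p *_) D₀) μ   ≡⟨ cong sumℤ (sym (Listₚ.map-∘ D₀)) ⟩
        Σℤ D₀ (λ e → μ (p * e))     ≡⟨ Σℤ-cong D₀ (λ e∈ →
                                         let (e∈D , p∤e) = ∈-filter⁻ (¬? ∘ (p ∣?_)) {xs = D} e∈ in
                                         μ-prime-* {{proj₁ (∈-divisors⁻ e∈D)}} pp p∤e) ⟩
        Σℤ D₀ (λ e → ℤ.- μ e)       ≡⟨ Σℤ-neg D₀ μ ⟩
        ℤ.- Σℤ D₀ μ                 ∎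

-- Counting primitive words by Möbius inversion

-- Such a word is a free choice of its first `e` letters, repeated.
periodic-size : ∀ {k n} .{{_ : NonZero n}} e .{{_ : NonZero e}} → e ∣ n →
                HasSize {Vec (Fin k) n} (λ w → Period (periodic w) e) (k ^ e)
periodic-size {k} {n} e@(suc d) e∣n = HasSize-bij repeat
  (λ {u} _ → power⇒period (repeat u) e∣n u (lookup∘tabulate _))
  (λ {u} {v} _ _ eq → Vec-ext λ j → trans (sym (repeat-lookup u j)) (trans (cong (λ w → lookup w (Fin.inject≤ j e≤n)) eq) (repeat-lookup v j)))
  (λ {w} p → let (u , eq) = period⇒power w p in
    u , _ , Vec-ext (λ i → trans (lookup∘tabulate _ i) (sym (eq i))))
  (HasSize-Vec k e)
  where
  e≤n : e ≤ n
  e≤n = Div.∣⇒≤ e∣n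
  repeat : Vec (Fin k) e → Vec (Fin k) n
  repeat u = tabulate (λ i → lookup u (toℕ i mod e))
  repeat-lookup : ∀ u j → lookup (repeat u) (Fin.inject≤ j e≤n) ≡ lookup u j
  repeat-lookup u j = trans (lookup∘tabulate _ (Fin.inject≤ j e≤n))
    (cong (lookup u) (trans (cong (_mod e) (Finₚ.toℕ-inject≤ j e≤n)) (toℕ-mod j)))

module _ (k n : ℕ) .{{n≢0 : NonZero n}} where

  private
    words : List (Vec (Fin k) n)
    words = proj₁ (HasSize-Vec k n)

    words-unique : Unique words
    words-unique = proj₁ (proj₂ (HasSize-Vec k n))

    ∈-words : ∀ w → w ∈ words
    ∈-words w = from (proj₁ (proj₂ (proj₂ (HasSize-Vec k n))) w) tt

    period? : ∀ e w → Dec (Period (periodic {k} {n} w) e)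
    period? e w = Period? Fin._≟_ (periodic-period w) e

    module LeastPeriod (w : Vec (Fin k) n) where

      least-period = leastPeriod Fin._≟_ (periodic-period w)

      e : ℕ
      e = suc (proj₁ least-period)

      e-period : Period (periodic w) e
      e-period = proj₁ (proj₂ least-period)

      e∣period : ∀ {d} → Period (periodic w) d → e ∣ d
      e∣period = proj₂ (proj₂ least-period) _

      -- The exponent of `w`: the word is the q-th power of its primitive root, which has length
      -- `e`.
      q : ℕ
      q = Div.quotient (e∣period (periodic-period w))

      n≡q*e : n ≡ q * e
      n≡q*e = _∣_.equality (e∣period (periodic-period w))

      q≢0 : NonZero q
      q≢0 = Div.quotient≢0 (e∣period (periodic-period w))

      primitive⇒q≡1 : Primitive w → q ≡ 1
      primitive⇒q≡1 prim = ℕₚ.*-cancelʳ-≡ q 1 e (trans (sym n≡q*e)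
        (trans (Div.∣-antisym (primitive⇒n∣period w prim e e-period) (e∣period (periodic-period w)))
          (sym (ℕₚ.*-identityˡ e))))

      q≡1⇒primitive : q ≡ 1 → Primitive w
      q≡1⇒primitive q≡1 (d , d<n , d∣n , u , eq) = ℕₚ.<⇒≱ d<n
        (subst (_≤ suc d) (sym (trans n≡q*e (trans (cong (_* e) q≡1) (ℕₚ.*-identityˡ e))))
          (Div.∣⇒≤ (e∣period (power⇒period w d∣n u eq))))

    open LeastPeriod

    -- Decided through the exponent, so that its `indicator` is by definition that of q = 1, the
    -- value of the Möbius sum over the divisors of q.
    primitive? : ∀ w → Dec (Primitive {k} {n} w)
    primitive? w = map′ (q≡1⇒primitive w) (primitive⇒q≡1 w) (q w ℕ.≟ 1)

    -- With d = m + 1, the power k^(n/d) counts the words of period n/d. Written as a sum of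
    -- indicators over words, it lets the two summations be exchanged, leaving a sum over d for each
    -- single word.
    term : ℕ → Vec (Fin k) n → ℤ
    term m w = if does (suc m ∣? n) then μ (suc m) ℤ.* indicator (period? (n ℕ./ suc m) w) else + 0

    k^[n/d] : ∀ m → suc m ∣ n → + (k ^ (n ℕ./ suc m)) ≡ Σℤ words (λ w → indicator (period? (n ℕ./ suc m) w))
    k^[n/d] m d∣n = trans (cong +_ (HasSize-unique
        (periodic-size (n ℕ./ suc m) {{ℕ.>-nonZero (DivMod.m≥n⇒m/n>0 (Div.∣⇒≤ d∣n))}}
          (Div.m/n∣m d∣n))
        (HasSize-filter (period? (n ℕ./ suc m)) words-unique ∈-words)))
      (sym (Σℤ-indicator (period? (n ℕ./ suc m)) words))

    mobius-term : ∀ m → (if does (suc m ∣? n) then μ (suc m) ℤ.* (+ (k ^ (n ℕ./ suc m))) else + 0)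
                        ≡ Σℤ words (term m)
    mobius-term m with suc m ∣? n
    ... | yes d∣n = trans (if-yes (suc m ∣? n) d∣n)
      (trans (cong (ℤ._*_ (μ (suc m))) (k^[n/d] m d∣n))
        (trans (sym (Σℤ-*ˡ (μ (suc m)) words _))
          (Σℤ-cong words (λ _ → sym (if-yes (suc m ∣? n) d∣n)))))
    ... | no d∤n = trans (if-no (suc m ∣? n) d∤n)
      (trans (sym (Σℤ-zero words))
        (Σℤ-cong words (λ _ → sym (if-no (suc m ∣? n) d∤n))))

    -- n/d is a period of w = u^q, u primitive, iff d ∣ q.
    term-quotient : ∀ w m → term m w ≡ (if does (suc m ∣? q w) then μ (suc m) else + 0)
    term-quotient w m with suc m ∣? q w
    ... | yes d∣q@(divides f q≡fd) = begin
      term m w  ≡⟨ if-yes (suc m ∣? n) d∣n ⟩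
      μ (suc m) ℤ.* indicator (period? (n ℕ./ suc m) w) ≡⟨ cong (ℤ._*_ (μ (suc m))) (if-yes (period? (n ℕ./ suc m) w) isPeriod) ⟩
      μ (suc m) ℤ.* + 1  ≡⟨ ℤₚ.*-identityʳ (μ (suc m)) ⟩
      μ (suc m)  ≡⟨ if-yes (suc m ∣? q w) d∣q ⟨
      (if does (suc m ∣? q w) then μ (suc m) else + 0) ∎
      where
      open ≡-Reasoning
      d∣n : suc m ∣ n
      d∣n = subst (suc m ∣_) (sym (n≡q*e w)) (Div.∣m⇒∣m*n (e w) d∣q)
      n≡fe*d : n ≡ f * e w * suc m
      n≡fe*d = begin
        n                   ≡⟨ n≡q*e w ⟩
        q w * e w           ≡⟨ cong (_* e w) q≡fd ⟩
        f * suc m * e w     ≡⟨ ℕₚ.*-assoc f (suc m) (e w) ⟩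
        f * (suc m * e w)   ≡⟨ cong (f *_) (ℕₚ.*-comm (suc m) (e w)) ⟩
        f * (e w * suc m)   ≡⟨ ℕₚ.*-assoc f (e w) (suc m) ⟨
        f * e w * suc m     ∎
      isPeriod : Period (periodic w) (n ℕ./ suc m)
      isPeriod = subst (Period (periodic w))
        (sym (trans (cong (ℕ._/ suc m) n≡fe*d) (DivMod.m*n/n≡m (f * e w) (suc m))))
        (Period-* f (e-period w))
    ... | no d∤q = trans vanish (sym (if-no (suc m ∣? q w) d∤q))
      where
      vanish : term m w ≡ + 0
      vanish with suc m ∣? n
      ... | no d∤n = if-no (suc m ∣? n) d∤n
      ... | yes d∣n = trans (if-yes (suc m ∣? n) d∣n)
        (trans (cong (ℤ._*_ (μ (suc m))) (if-no (period? (n ℕ./ suc m) w) notPeriod))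
          (ℤₚ.*-zeroʳ (μ (suc m))))
        where
        notPeriod : ¬ Period (periodic w) (n ℕ./ suc m)
        -- The least period e divides n/d, so e d divides n = q e, and cancelling e gives d ∣ q.
        notPeriod p = d∤q (Div.*-cancelʳ-∣ (e w) (subst₂ _∣_ (ℕₚ.*-comm (e w) (suc m))
          (trans (DivMod.m/n*n≡m d∣n) (n≡q*e w)) (Div.*-monoˡ-∣ (suc m) (e∣period w p))))

    Σterm : ∀ w → Σℤ (upTo n) (λ m → term m w) ≡ indicator (primitive? w)
    Σterm w = begin
      Σℤ (upTo n) (λ m → term m w)
        ≡⟨ Σℤ-cong (upTo n) (λ {m} _ → term-quotient w m) ⟩
      Σℤ (upTo n) (λ m → if does (suc m ∣? q w) then μ (suc m) else + 0)
        ≡⟨ cong sumℤ (Listₚ.map-∘ (upTo n)) ⟩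
      Σℤ (List.map suc (upTo n)) (λ d → if does (d ∣? q w) then μ d else + 0)
        ≡⟨ Σℤ-filter (_∣? q w) (List.map suc (upTo n)) μ ⟩
      Σℤ (divisorsUpTo n (q w)) μ
        ≡⟨ Σμ-divisors {{q≢0 w}} q≤n ⟩
      indicator (q w ℕ.≟ 1)
        ≡⟨⟩
      indicator (primitive? w) ∎
      where
      open ≡-Reasoning
      q≤n : q w ≤ n
      q≤n = subst (q w ≤_) (sym (n≡q*e w)) (ℕₚ.m≤m*n (q w) (e w))

  mobiusSum-primitive : ∀ {N} → HasSize {Vec (Fin k) n} Primitive N → mobiusSum k n ≡ + N
  mobiusSum-primitive {N} sz = begin
    mobiusSum k n                                           ≡⟨ Σℤ-cong (upTo n) (λ {m} _ → mobius-term m) ⟩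
    Σℤ (upTo n) (λ m → Σℤ words (term m))                   ≡⟨ Σℤ-swap (upTo n) words term ⟩
    Σℤ words (λ w → Σℤ (upTo n) (λ m → term m w))           ≡⟨ Σℤ-cong words (λ {w} _ → Σterm w) ⟩
    Σℤ words (λ w → indicator (primitive? w))               ≡⟨ Σℤ-indicator primitive? words ⟩
    + length (filter primitive? words)                      ≡⟨ cong +_ (HasSize-unique (HasSize-filter primitive? words-unique ∈-words) sz) ⟩
    + N                                                     ∎
    where open ≡-Reasoning

-- Rational arithmetic and the two equalities

-- Reduction to lowest terms hides the common denominator, so the identity is checked by
-- cross-multiplication among unnormalised fractions.
/-distribʳ-+ : ∀ x y n .{{_ : NonZero n}} → (x ℤ.+ y) / n ≡ (x / n) ℚ.+ (y / n)
/-distribʳ-+ x y n@(suc n-1) = ℚₚ.toℚᵘ-injective (begin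
  ℚ.toℚᵘ ((x ℤ.+ y) / n)                   ≈⟨ ℚₚ.toℚᵘ-fromℚᵘ (ℚᵘ.mkℚᵘ (x ℤ.+ y) n-1) ⟩
  ℚᵘ.mkℚᵘ (x ℤ.+ y) n-1                     ≈⟨ ℚᵘ.*≡* same ⟩
  ℚᵘ.mkℚᵘ x n-1 ℚᵘ.+ ℚᵘ.mkℚᵘ y n-1          ≈⟨ ℚᵘₚ.+-cong (ℚₚ.toℚᵘ-fromℚᵘ (ℚᵘ.mkℚᵘ x n-1)) (ℚₚ.toℚᵘ-fromℚᵘ (ℚᵘ.mkℚᵘ y n-1)) ⟨
  ℚ.toℚᵘ (x / n) ℚᵘ.+ ℚ.toℚᵘ (y / n)       ≈⟨ ℚₚ.toℚᵘ-homo-+ (x / n) (y / n) ⟨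
  ℚ.toℚᵘ ((x / n) ℚ.+ (y / n))             ∎)
  where
  open import Relation.Binary.Reasoning.Setoid ℚᵘₚ.≃-setoid
  same : (x ℤ.+ y) ℤ.* (+ (n * n)) ≡ (x ℤ.* + n ℤ.+ y ℤ.* + n) ℤ.* + n
  same = trans (cong (ℤ._*_ (x ℤ.+ y)) (ℤₚ.pos-* n n))
    (trans (sym (ℤₚ.*-assoc (x ℤ.+ y) (+ n) (+ n))) (cong (ℤ._* + n) (ℤₚ.*-distribʳ-+ (+ n) x y)))

[m*n]/n≡m : ∀ m n .{{_ : NonZero n}} → + (m * n) / n ≡ ℕtoℚ m
[m*n]/n≡m m n@(suc n-1) = ℚₚ.fromℚᵘ-cong {ℚᵘ.mkℚᵘ (+ (m * n)) n-1} {ℚᵘ.mkℚᵘ (+ m) 0}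
  (ℚᵘ.*≡* (trans (ℤₚ.*-identityʳ (+ (m * n))) (ℤₚ.pos-* m n)))

[p+q]-p≡q : ∀ p q → (p ℚ.+ q) - p ≡ q
[p+q]-p≡q p q = begin
  (p ℚ.+ q) - p             ≡⟨ cong (_- p) (ℚₚ.+-comm p q) ⟩
  (q ℚ.+ p) - p             ≡⟨ ℚₚ.+-assoc q p (ℚ.- p) ⟩
  q ℚ.+ (p - p)             ≡⟨ cong (ℚ._+_ q) (ℚₚ.+-inverseʳ p) ⟩
  q ℚ.+ ℚ.0ℚ                ≡⟨ ℚₚ.+-identityʳ q ⟩
  q                         ∎
  where open ≡-Reasoning

sumℚ-ℕtoℚ : (f : ℕ → ℕ) (is : List ℕ) → sumℚ (List.map (λ i → ℕtoℚ (f i)) is) ≡ ℕtoℚ (sum (List.map f is))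
sumℚ-ℕtoℚ f []       = refl
sumℚ-ℕtoℚ f (i ∷ is) = trans (cong (ℚ._+_ (ℕtoℚ (f i))) (sumℚ-ℕtoℚ f is))
  (trans (sym (/-distribʳ-+ (+ f i) (+ sum (List.map f is)) 1))
    (cong (_/ 1) (sym (ℤₚ.pos-+ (f i) (sum (List.map f is))))))

sum-map-*ʳ : (f : ℕ → ℕ) (n : ℕ) (is : List ℕ) → sum (List.map (λ i → f i * n) is) ≡ sum (List.map f is) * n
sum-map-*ʳ f n []       = refl
sum-map-*ʳ f n (i ∷ is) = trans (cong (_+_ (f i * n)) (sum-map-*ʳ f n is)) (sym (ℕₚ.*-distribʳ-+ n (f i) _))

-- Isolates the top index i = k. It carries the patterns that are new with the k-th letter, and in
-- the word count it is the term to be solved for.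
sum-indices-suc : (f : ℕ → ℕ) (m : ℕ) →
  sum (List.map f (indices (2 + m))) ≡ sum (List.map f (indices (1 + m))) + f (2 + m)
sum-indices-suc f m = begin
  sum (List.map f (List.map (_+_ 2) (upTo (suc m))))            ≡⟨ cong (λ is → sum (List.map f (List.map (_+_ 2) is))) (Listₚ.upTo-∷ʳ m) ⟨
  sum (List.map f (List.map (_+_ 2) (upTo m List.++ m ∷ [])))   ≡⟨ cong (λ is → sum (List.map f is)) (Listₚ.map-++ (_+_ 2) (upTo m) _) ⟩
  sum (List.map f (indices (1 + m) List.++ (2 + m) ∷ []))      ≡⟨ cong sum (Listₚ.map-++ f (indices (1 + m)) _) ⟩
  sum (List.map f (indices (1 + m)) List.++ f (2 + m) ∷ [])    ≡⟨ sum-++ (List.map f (indices (1 + m))) _ ⟩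
  sum (List.map f (indices (1 + m))) + (f (2 + m) + 0)         ≡⟨ cong (_+_ (sum (List.map f (indices (1 + m))))) (ℕₚ.+-identityʳ _) ⟩
  sum (List.map f (indices (1 + m))) + f (2 + m)               ∎
  where open ≡-Reasoning

theorem3p8 : (k n : ℕ) .{{_ : NonZero n}} → 3 ≤ k → 2 ≤ n →
    (a b : ℕ) (c : ℕ → ℕ) →
    HasSize (InPatterns (allPlus k) n) a →
    HasSize (InPatterns (allPlus (k ∸ 1)) n) b →
    (∀ i → HasSize (CycDesc n i) (c i)) →
    ((+ a / n) - (+ b / n) ≡ ℕtoℚ (c k))
    × (ℕtoℚ (c k) ≡ L k n - binomSum k n c)
theorem3p8 k@(suc (suc m)) n (s≤s (s≤s _)) 2≤n a b c sizeₖ sizeₖ₋₁ sizes = patternDifference , recurrence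
  where
  open ≡-Reasoning

  a≡b+cₖn : a ≡ b + c k * n
  a≡b+cₖn = begin
    a                                                         ≡⟨ HasSize-unique sizeₖ (patterns-size k n 2≤n c sizes) ⟩
    sum (List.map (λ i → c i * n) (indices k))                ≡⟨ sum-indices-suc (λ i → c i * n) m ⟩
    sum (List.map (λ i → c i * n) (indices (suc m))) + c k * n
      ≡⟨ cong (_+ c k * n) (HasSize-unique (patterns-size (suc m) n 2≤n c sizes) sizeₖ₋₁) ⟩
    b + c k * n                                               ∎

  patternDifference : (+ a / n) - (+ b / n) ≡ ℕtoℚ (c k)
  patternDifference = begin
    (+ a / n) - (+ b / n)                       ≡⟨ cong (λ z → (+ z / n) - (+ b / n)) a≡b+cₖn ⟩
    (+ (b + c k * n) / n) - (+ b / n)           ≡⟨ cong (λ z → (z / n) - (+ b / n)) (ℤₚ.pos-+ b (c k * n)) ⟩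
    ((+ b ℤ.+ + (c k * n)) / n) - (+ b / n)     ≡⟨ cong (_- (+ b / n)) (/-distribʳ-+ (+ b) (+ (c k * n)) n) ⟩
    ((+ b / n) ℚ.+ (+ (c k * n) / n)) - (+ b / n) ≡⟨ [p+q]-p≡q (+ b / n) (+ (c k * n) / n) ⟩
    + (c k * n) / n                             ≡⟨ [m*n]/n≡m (c k) n ⟩
    ℕtoℚ (c k)                                  ∎

  weight : ℕ → ℕ
  weight i = (((n + k) ∸ i) C (k ∸ i)) * c i

  S : ℕ
  S = sum (List.map weight (indices (suc m)))

  -- With k - 1 descents and k letters every rise is forced, so there is exactly one labelling.
  weightₖ : weight k ≡ c k
  weightₖ = begin
    (((n + k) ∸ k) C (k ∸ k)) * c k   ≡⟨ cong₂ (λ x y → (x C y) * c k) (ℕₚ.m+n∸n≡m n k) (ℕₚ.n∸n≡0 k) ⟩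
    (n C 0) * c k                     ≡⟨ cong (_* c k) (trans (nCk≡nC[n∸k] {0} {n} z≤n) (nCn≡1 n)) ⟩
    1 * c k                           ≡⟨ ℕₚ.*-identityˡ (c k) ⟩
    c k                               ∎

  weight-* : ∀ i → c i * (n * (((n + k) ∸ i) C (k ∸ i))) ≡ weight i * n
  weight-* i = let B = ((n + k) ∸ i) C (k ∸ i) in begin
    c i * (n * B)   ≡⟨ cong (c i *_) (ℕₚ.*-comm n B) ⟩
    c i * (B * n)   ≡⟨ ℕₚ.*-assoc (c i) B n ⟨
    c i * B * n     ≡⟨ cong (_* n) (ℕₚ.*-comm (c i) B) ⟩
    B * c i * n     ∎

  -- The primitive words counted in two ways: by Möbius inversion on the left, by labelled rooted
  -- cycles on the right.
  mobius : mobiusSum k n ≡ + ((S + c k) * n)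
  mobius = begin
    mobiusSum k n     ≡⟨ mobiusSum-primitive k n (primitive-size k n 2≤n c sizes) ⟩
    + sum (List.map (λ i → c i * (n * (((n + k) ∸ i) C (k ∸ i)))) (indices k))
                      ≡⟨ cong (λ l → + sum l) (Listₚ.map-cong weight-* (indices k)) ⟩
    + sum (List.map (λ i → weight i * n) (indices k))
                      ≡⟨ cong +_ (sum-map-*ʳ weight n (indices k)) ⟩
    + (sum (List.map weight (indices k)) * n)
                      ≡⟨ cong (λ z → + (z * n)) (trans (sum-indices-suc weight m) (cong (_+_ S) weightₖ)) ⟩
    + ((S + c k) * n) ∎

  recurrence : ℕtoℚ (c k) ≡ L k n - binomSum k n c
  recurrence = sym (begin
    L k n - binomSum k n c              ≡⟨ cong₂ (λ x y → (x / n) - y) mobius (sumℚ-ℕtoℚ weight (indices (suc m))) ⟩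
    (+ ((S + c k) * n) / n) - ℕtoℚ S    ≡⟨ cong (_- ℕtoℚ S) ([m*n]/n≡m (S + c k) n) ⟩
    ℕtoℚ (S + c k) - ℕtoℚ S             ≡⟨ cong (λ z → (z / 1) - ℕtoℚ S) (ℤₚ.pos-+ S (c k)) ⟩
    ((+ S ℤ.+ + c k) / 1) - ℕtoℚ S      ≡⟨ cong (_- ℕtoℚ S) (/-distribʳ-+ (+ S) (+ c k) 1) ⟩
    (ℕtoℚ S ℚ.+ ℕtoℚ (c k)) - ℕtoℚ S    ≡⟨ [p+q]-p≡q (ℕtoℚ S) (ℕtoℚ (c k)) ⟩
    ℕtoℚ (c k)                          ∎)
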